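{- Let $p$ be a prime, let $f\ge1$, and let $q\ge1$ be a power of $p$. For $0\le i\le p^f-2$ and $0\le r\le q-1$ let $A_{i,r}=\{m\ge0: m\equiv i\pmod{p^f-1},\ m\equiv r\pmod q\}$. Let $s(n)_{n\ge0}$ be a sequence of $p$-adic integers with an approximate twisted interpolation $\{(s_{i,r},A_{i,r}):0\le i\le p^f-2,\ 0\le r\le q-1\}$. Then $$\lim_{\alpha\to\infty}\frac{|\{s(n)\bmod p^\alpha:n\ge0\}|}{p^\alpha}=\mu\Big(\mathbb{Z}_p\cap\bigcup_{i,r}s_{i,r}(r+q\mathbb{Z}_p)\Big).$$
   Context: Here each $s_{i,r}:\mathbb{Z}_p\to K$ is continuous, $K$ a finite extension of $\mathbb{Q}_p$ with the unique absolute value $|\cdot|_p$ extending the $p$-adic one, and "approximate twisted interpolation" means there are constants $C\ge0$, $0\le D<1$ with $|s(n)-s_{i,r}(n)|_p\le CD^n$ for all $n\in A_{i,r}$ and all $i,r$. $\mathbb{Z}_p$ is regarded as a subset of $K$. $\mu$ is the Haar measure on $\mathbb{Z}_p$ normalized by $\mu(m+p^\alpha\mathbb{Z}_p)=p^{ -\alpha}$. -}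

module Defs where

open import Algebra.Bundles using (CommutativeRing)
open import Algebra.Bundles.Raw using (RawRing)
import Algebra.Definitions.RawMonoid as RawMonoidDefs
open import Algebra.Morphism.Structures using (IsRingHomomorphism)
open import Axiom.ExcludedMiddle using (ExcludedMiddle)
open import Data.Fin.Base using (Fin; toℕ)
open import Data.Integer.Base as ℤ using (ℤ; +_)
open import Data.Integer.Divisibility.Signed using (_∣_; divides; ∣m∣n⇒∣m+n; ∣m⇒∣-m; ∣n⇒∣m*n; ∣m⇒∣m*n)
open import Data.Integer.Solver using () renaming (module +-*-Solver to ℤ-Solver)
open import Data.List.Base using (allFin; filter; length)
open import Data.Nat.Base as ℕ using (ℕ; zero; suc)
import Data.Nat.Properties as ℕ
open import Data.Nat.Primality using (Prime; prime⇒nonZero)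
open import Data.Product.Base using (∃-syntax; Σ-syntax; _×_; _,_)
open import Data.Rational.Base as ℚ using (ℚ; 0ℚ; 1ℚ; ½)
import Data.Rational.Properties as ℚ
open import Data.Rational.Solver using () renaming (module +-*-Solver to ℚ-Solver)
open import Data.Sum.Base using (inj₁; inj₂)
open import Level using (0ℓ)
open import Relation.Binary.PropositionalEquality using (_≡_; _≢_; refl; sym; trans; cong; cong₂; subst)
open import Relation.Nullary using (¬_)
open import Relation.Unary using (Pred; _∈_; _⊆_; _≐_; _⊥_; ∁; ⋃)

------------------------------------------------------------------------
-- Real numbers: Cauchy sequences of rationals, up to _≈_

module Real where

  IsCauchy : (ℕ → ℚ) → Set
  IsCauchy x = ∀ ε → 0ℚ ℚ.< ε →
    ∃[ N ] (∀ m n → N ℕ.≤ m → N ℕ.≤ n → ℚ.∣ x m ℚ.- x n ∣ ℚ.< ε)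

  record ℝ : Set where
    constructor mkℝ
    field
      seq    : ℕ → ℚ
      cauchy : IsCauchy seq

  open ℝ public

  infix 4 _≈_ _≤_ _<_
  infixl 6 _+_ _-_
  infixl 7 _*_
  infixr 8 _^_

  _≈_ : ℝ → ℝ → Set
  x ≈ y = ∀ ε → 0ℚ ℚ.< ε → ∃[ N ] (∀ n → N ℕ.≤ n → ℚ.∣ seq x n ℚ.- seq y n ∣ ℚ.< ε)

  _≤_ : ℝ → ℝ → Set
  x ≤ y = ∀ ε → 0ℚ ℚ.< ε → ∃[ N ] (∀ n → N ℕ.≤ n → seq x n ℚ.< seq y n ℚ.+ ε)

  _<_ : ℝ → ℝ → Set
  x < y = ∃[ ε ] (0ℚ ℚ.< ε × ∃[ N ] (∀ n → N ℕ.≤ n → seq x n ℚ.+ ε ℚ.< seq y n))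

  fromℚ : ℚ → ℝ
  fromℚ a = mkℝ (λ _ → a) λ ε 0<ε → 0 , λ _ _ _ _ →
    subst (ℚ._< ε) (sym (cong ℚ.∣_∣ (ℚ.+-inverseʳ a))) 0<ε

  0ℝ 1ℝ : ℝ
  0ℝ = fromℚ 0ℚ
  1ℝ = fromℚ 1ℚ

  private
    half : ∀ ε → 0ℚ ℚ.< ε → 0ℚ ℚ.< ½ ℚ.* ε
    half ε 0<ε = subst (ℚ._< ½ ℚ.* ε) (ℚ.*-zeroʳ ½) (ℚ.*-monoʳ-<-pos ½ 0<ε)

    half+half : ∀ ε → ½ ℚ.* ε ℚ.+ ½ ℚ.* ε ≡ ε
    half+half ε = trans (sym (ℚ.*-distribʳ-+ ε ½ ½)) (ℚ.*-identityˡ ε)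

    +-cauchy : ∀ {x y} → IsCauchy x → IsCauchy y → IsCauchy (λ n → x n ℚ.+ y n)
    +-cauchy {x} {y} cx cy ε 0<ε with cx (½ ℚ.* ε) (half ε 0<ε) | cy (½ ℚ.* ε) (half ε 0<ε)
    ... | M , hx | N , hy = M ℕ.⊔ N , λ m n m≥ n≥ → begin-strict
      ℚ.∣ (x m ℚ.+ y m) ℚ.- (x n ℚ.+ y n) ∣
        ≡⟨ cong ℚ.∣_∣ (solve 4 (λ a b c d → (a :+ b) :- (c :+ d) := (a :- c) :+ (b :- d)) refl (x m) (y m) (x n) (y n)) ⟩
      ℚ.∣ (x m ℚ.- x n) ℚ.+ (y m ℚ.- y n) ∣
        ≤⟨ ℚ.∣p+q∣≤∣p∣+∣q∣ (x m ℚ.- x n) (y m ℚ.- y n) ⟩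
      ℚ.∣ x m ℚ.- x n ∣ ℚ.+ ℚ.∣ y m ℚ.- y n ∣
        <⟨ ℚ.+-mono-< (hx m n (ℕ.m⊔n≤o⇒m≤o M N m≥) (ℕ.m⊔n≤o⇒m≤o M N n≥))
                      (hy m n (ℕ.m⊔n≤o⇒n≤o M N m≥) (ℕ.m⊔n≤o⇒n≤o M N n≥)) ⟩
      ½ ℚ.* ε ℚ.+ ½ ℚ.* ε
        ≡⟨ half+half ε ⟩
      ε ∎
      where
      open ℚ.≤-Reasoning
      open ℚ-Solver

    neg-cauchy : ∀ {x} → IsCauchy x → IsCauchy (λ n → ℚ.- x n)
    neg-cauchy {x} cx ε 0<ε with cx ε 0<ε
    ... | N , hx = N , λ m n m≥ n≥ → subst (ℚ._< ε)
      (trans (sym (ℚ.∣-p∣≡∣p∣ (x m ℚ.- x n)))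
             (cong ℚ.∣_∣ (solve 2 (λ a b → :- (a :- b) := (:- a) :- (:- b)) refl (x m) (x n))))
      (hx m n m≥ n≥)
      where open ℚ-Solver

    ∣a∣-∣b∣≤ : ∀ a b → ℚ.∣ a ∣ ℚ.- ℚ.∣ b ∣ ℚ.≤ ℚ.∣ a ℚ.- b ∣
    ∣a∣-∣b∣≤ a b = begin
      ℚ.∣ a ∣ ℚ.- ℚ.∣ b ∣
        ≡⟨ cong (λ t → ℚ.∣ t ∣ ℚ.- ℚ.∣ b ∣) (solve 2 (λ a b → a := (a :- b) :+ b) refl a b) ⟩
      ℚ.∣ (a ℚ.- b) ℚ.+ b ∣ ℚ.- ℚ.∣ b ∣
        ≤⟨ ℚ.+-monoˡ-≤ (ℚ.- ℚ.∣ b ∣) (ℚ.∣p+q∣≤∣p∣+∣q∣ (a ℚ.- b) b) ⟩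
      ℚ.∣ a ℚ.- b ∣ ℚ.+ ℚ.∣ b ∣ ℚ.- ℚ.∣ b ∣
        ≡⟨ solve 2 (λ u v → (u :+ v) :- v := u) refl ℚ.∣ a ℚ.- b ∣ ℚ.∣ b ∣ ⟩
      ℚ.∣ a ℚ.- b ∣ ∎
      where
      open ℚ.≤-Reasoning
      open ℚ-Solver

    ∣a-b∣≡∣b-a∣ : ∀ a b → ℚ.∣ a ℚ.- b ∣ ≡ ℚ.∣ b ℚ.- a ∣
    ∣a-b∣≡∣b-a∣ a b = trans (sym (ℚ.∣-p∣≡∣p∣ (a ℚ.- b)))
      (cong ℚ.∣_∣ (solve 2 (λ a b → :- (a :- b) := b :- a) refl a b))
      where open ℚ-Solver

    ∣∣-lub : ∀ {c} b → b ℚ.≤ c → ℚ.- b ℚ.≤ c → ℚ.∣ b ∣ ℚ.≤ c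
    ∣∣-lub {c} b b≤c -b≤c with ℚ.∣p∣≡p∨∣p∣≡-p b
    ... | inj₁ e = subst (ℚ._≤ c) (sym e) b≤c
    ... | inj₂ e = subst (ℚ._≤ c) (sym e) -b≤c

    ∣∣-cauchy : ∀ {x} → IsCauchy x → IsCauchy (λ n → ℚ.∣ x n ∣)
    ∣∣-cauchy {x} cx ε 0<ε with cx ε 0<ε
    ... | N , hx = N , λ m n m≥ n≥ → ℚ.≤-<-trans
      (∣∣-lub (ℚ.∣ x m ∣ ℚ.- ℚ.∣ x n ∣) (∣a∣-∣b∣≤ (x m) (x n))
        (begin
          ℚ.- (ℚ.∣ x m ∣ ℚ.- ℚ.∣ x n ∣)
            ≡⟨ solve 2 (λ a b → :- (a :- b) := b :- a) refl ℚ.∣ x m ∣ ℚ.∣ x n ∣ ⟩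
          ℚ.∣ x n ∣ ℚ.- ℚ.∣ x m ∣
            ≤⟨ ∣a∣-∣b∣≤ (x n) (x m) ⟩
          ℚ.∣ x n ℚ.- x m ∣
            ≡⟨ ∣a-b∣≡∣b-a∣ (x n) (x m) ⟩
          ℚ.∣ x m ℚ.- x n ∣ ∎))
      (hx m n m≥ n≥)
      where
      open ℚ.≤-Reasoning
      open ℚ-Solver

    bounded : ∀ {x} → IsCauchy x →
      ∃[ B ] (ℚ.Positive B × ∃[ N ] (∀ n → N ℕ.≤ n → ℚ.∣ x n ∣ ℚ.≤ B))
    bounded {x} cx with cx 1ℚ (ℚ.positive⁻¹ 1ℚ)
    ... | N , hx = 1ℚ ℚ.+ ℚ.∣ x N ∣
        , ℚ.pos+nonNeg⇒pos 1ℚ ℚ.∣ x N ∣ {{ℚ.∣-∣-nonNeg (x N)}}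
        , N , λ n n≥ → begin
          ℚ.∣ x n ∣
            ≡⟨ cong ℚ.∣_∣ (solve 2 (λ a b → a := (a :- b) :+ b) refl (x n) (x N)) ⟩
          ℚ.∣ (x n ℚ.- x N) ℚ.+ x N ∣
            ≤⟨ ℚ.∣p+q∣≤∣p∣+∣q∣ (x n ℚ.- x N) (x N) ⟩
          ℚ.∣ x n ℚ.- x N ∣ ℚ.+ ℚ.∣ x N ∣
            ≤⟨ ℚ.+-monoˡ-≤ ℚ.∣ x N ∣ (ℚ.<⇒≤ (hx n N n≥ ℕ.≤-refl)) ⟩
          1ℚ ℚ.+ ℚ.∣ x N ∣ ∎
      where
      open ℚ.≤-Reasoning
      open ℚ-Solver

    divide : ∀ B → ℚ.Positive B → ∀ ε → 0ℚ ℚ.< ε → ∃[ δ ] (0ℚ ℚ.< δ × B ℚ.* δ ≡ ε)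
    divide B B>0 ε 0<ε = B⁻¹ ℚ.* ε
      , subst (ℚ._< B⁻¹ ℚ.* ε) (ℚ.*-zeroʳ B⁻¹)
          (ℚ.*-monoʳ-<-pos B⁻¹ {{ℚ.1/pos⇒pos B {{B>0}}}} 0<ε)
      , trans (sym (ℚ.*-assoc B B⁻¹ ε))
          (trans (cong (ℚ._* ε) (ℚ.*-inverseʳ B {{ℚ.pos⇒nonZero B {{B>0}}}})) (ℚ.*-identityˡ ε))
      where
      B⁻¹ : ℚ
      B⁻¹ = ℚ.1/_ B {{ℚ.pos⇒nonZero B {{B>0}}}}

    ∣∣*-bound : ∀ a b {A δ} → ℚ.Positive A → ℚ.∣ a ∣ ℚ.≤ A → ℚ.∣ b ∣ ℚ.< δ →
      ℚ.∣ a ℚ.* b ∣ ℚ.< A ℚ.* δ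
    ∣∣*-bound a b {A} {δ} A>0 a≤A b<δ = begin-strict
      ℚ.∣ a ℚ.* b ∣          ≡⟨ ℚ.∣p*q∣≡∣p∣*∣q∣ a b ⟩
      ℚ.∣ a ∣ ℚ.* ℚ.∣ b ∣    ≤⟨ ℚ.*-monoʳ-≤-nonNeg ℚ.∣ b ∣ {{ℚ.∣-∣-nonNeg b}} a≤A ⟩
      A ℚ.* ℚ.∣ b ∣          <⟨ ℚ.*-monoʳ-<-pos A {{A>0}} b<δ ⟩
      A ℚ.* δ                ∎
      where open ℚ.≤-Reasoning

    *-estimate : ∀ a b c d {A B δ η} → ℚ.Positive A → ℚ.Positive B →
      ℚ.∣ a ∣ ℚ.≤ A → ℚ.∣ d ∣ ℚ.≤ B → ℚ.∣ b ℚ.- d ∣ ℚ.< δ → ℚ.∣ a ℚ.- c ∣ ℚ.< η →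
      ℚ.∣ a ℚ.* b ℚ.- c ℚ.* d ∣ ℚ.< A ℚ.* δ ℚ.+ B ℚ.* η
    *-estimate a b c d {A} {B} {δ} {η} A>0 B>0 a≤A d≤B b-d<δ a-c<η = begin-strict
      ℚ.∣ a ℚ.* b ℚ.- c ℚ.* d ∣
        ≡⟨ cong ℚ.∣_∣ (solve 4 (λ a b c d → a :* b :- c :* d := a :* (b :- d) :+ d :* (a :- c)) refl a b c d) ⟩
      ℚ.∣ a ℚ.* (b ℚ.- d) ℚ.+ d ℚ.* (a ℚ.- c) ∣
        ≤⟨ ℚ.∣p+q∣≤∣p∣+∣q∣ (a ℚ.* (b ℚ.- d)) (d ℚ.* (a ℚ.- c)) ⟩
      ℚ.∣ a ℚ.* (b ℚ.- d) ∣ ℚ.+ ℚ.∣ d ℚ.* (a ℚ.- c) ∣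
        <⟨ ℚ.+-mono-< (∣∣*-bound a (b ℚ.- d) A>0 a≤A b-d<δ) (∣∣*-bound d (a ℚ.- c) B>0 d≤B a-c<η) ⟩
      A ℚ.* δ ℚ.+ B ℚ.* η ∎
      where
      open ℚ.≤-Reasoning
      open ℚ-Solver

    *-cauchy : ∀ {x y} → IsCauchy x → IsCauchy y → IsCauchy (λ n → x n ℚ.* y n)
    *-cauchy {x} {y} cx cy ε 0<ε =
      let A , A>0 , K , hA = bounded {x} cx
          B , B>0 , L , hB = bounded {y} cy
          δ , 0<δ , Aδ = divide A A>0 (½ ℚ.* ε) (half ε 0<ε)
          η , 0<η , Bη = divide B B>0 (½ ℚ.* ε) (half ε 0<ε)
          M , hy = cy δ 0<δ
          N , hx = cx η 0<η
      in (K ℕ.⊔ L) ℕ.⊔ (M ℕ.⊔ N) , λ m n m≥ n≥ →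
        let m≥KL = ℕ.m⊔n≤o⇒m≤o (K ℕ.⊔ L) (M ℕ.⊔ N) m≥
            n≥KL = ℕ.m⊔n≤o⇒m≤o (K ℕ.⊔ L) (M ℕ.⊔ N) n≥
            m≥MN = ℕ.m⊔n≤o⇒n≤o (K ℕ.⊔ L) (M ℕ.⊔ N) m≥
            n≥MN = ℕ.m⊔n≤o⇒n≤o (K ℕ.⊔ L) (M ℕ.⊔ N) n≥
        in subst (ℚ.∣ x m ℚ.* y m ℚ.- x n ℚ.* y n ∣ ℚ.<_)
             (trans (cong₂ ℚ._+_ Aδ Bη) (half+half ε))
             (*-estimate (x m) (y m) (x n) (y n) A>0 B>0
               (hA m (ℕ.m⊔n≤o⇒m≤o K L m≥KL)) (hB n (ℕ.m⊔n≤o⇒n≤o K L n≥KL))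
               (hy m n (ℕ.m⊔n≤o⇒m≤o M N m≥MN) (ℕ.m⊔n≤o⇒m≤o M N n≥MN))
               (hx m n (ℕ.m⊔n≤o⇒n≤o M N m≥MN) (ℕ.m⊔n≤o⇒n≤o M N n≥MN)))

  _+_ _-_ _*_ : ℝ → ℝ → ℝ
  x + y = mkℝ (λ n → seq x n ℚ.+ seq y n) (+-cauchy {seq x} {seq y} (cauchy x) (cauchy y))
  x - y = mkℝ (λ n → seq x n ℚ.- seq y n)
    (+-cauchy {seq x} {λ n → ℚ.- seq y n} (cauchy x) (neg-cauchy {seq y} (cauchy y)))
  x * y = mkℝ (λ n → seq x n ℚ.* seq y n) (*-cauchy {seq x} {seq y} (cauchy x) (cauchy y))

  ∣_∣ : ℝ → ℝ
  ∣ x ∣ = mkℝ (λ n → ℚ.∣ seq x n ∣) (∣∣-cauchy {seq x} (cauchy x))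

  _^_ : ℝ → ℕ → ℝ
  x ^ zero  = 1ℝ
  x ^ suc n = x * x ^ n

  partialSum : (ℕ → ℝ) → ℕ → ℝ
  partialSum x zero    = 0ℝ
  partialSum x (suc n) = partialSum x n + x n

  infix 4 _⟶_
  _⟶_ : (ℕ → ℝ) → ℝ → Set
  x ⟶ l = ∀ ε → 0ℝ < ε → ∃[ N ] (∀ n → N ℕ.≤ n → ∣ x n - l ∣ < ε)

open Real using (ℝ; 0ℝ; 1ℝ; fromℚ; partialSum; _⟶_)

------------------------------------------------------------------------

infix 4 _≡_[mod_]
_≡_[mod_] : ℤ → ℤ → ℕ → Set
a ≡ b [mod m ] = + m ∣ (a ℤ.- b)

private
  mod-refl : ∀ {m} a → a ≡ a [mod m ]
  mod-refl {m} a = divides (+ 0) (solve 2 (λ a m → a :- a := con (+ 0) :* m) refl a (+ m))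
    where open ℤ-Solver

  mod-+ : ∀ {m} a b c d → a ≡ b [mod m ] → c ≡ d [mod m ] → (a ℤ.+ c) ≡ (b ℤ.+ d) [mod m ]
  mod-+ {m} a b c d h k = subst (+ m ∣_)
    (solve 4 (λ a b c d → (a :- b) :+ (c :- d) := (a :+ c) :- (b :+ d)) refl a b c d)
    (∣m∣n⇒∣m+n h k)
    where open ℤ-Solver

  mod-neg : ∀ {m} a b → a ≡ b [mod m ] → (ℤ.- a) ≡ (ℤ.- b) [mod m ]
  mod-neg {m} a b h = subst (+ m ∣_)
    (solve 2 (λ a b → :- (a :- b) := (:- a) :- (:- b)) refl a b)
    (∣m⇒∣-m h)
    where open ℤ-Solver

  mod-* : ∀ {m} a b c d → a ≡ b [mod m ] → c ≡ d [mod m ] → (a ℤ.* c) ≡ (b ℤ.* d) [mod m ]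
  mod-* {m} a b c d h k = subst (+ m ∣_)
    (solve 4 (λ a b c d → a :* (c :- d) :+ (a :- b) :* d := a :* c :- b :* d) refl a b c d)
    (∣m∣n⇒∣m+n (∣n⇒∣m*n a k) (∣m⇒∣m*n d h))
    where open ℤ-Solver

-- Excluded middle supplies the membership test needed to count.
card : ExcludedMiddle 0ℓ → ∀ {n} → Pred (Fin n) 0ℓ → ℕ
card em {n} P = length (filter (λ a → em {P a}) (allFin n))

module Padic (p : ℕ) (p-prime : Prime p) where

  private instance
    p≢0 : ℕ.NonZero p
    p≢0 = prime⇒nonZero p-prime

  ----------------------------------------------------------------------
  -- ℤₚ as the inverse limit of the rings ℤ/pⁿ, each residue class being
  -- given by an arbitrary integer representative; equality is _≈ₚ_.

  record ℤₚ : Set where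
    constructor mkℤₚ
    field
      res      : ℕ → ℤ
      coherent : ∀ n → res (suc n) ≡ res n [mod p ℕ.^ n ]

  open ℤₚ public

  infix 4 _≈ₚ_
  infixl 6 _+ₚ_
  infixl 7 _*ₚ_
  infix 8 -ₚ_

  _≈ₚ_ : ℤₚ → ℤₚ → Set
  x ≈ₚ y = ∀ n → res x n ≡ res y n [mod p ℕ.^ n ]

  fromℤ : ℤ → ℤₚ
  fromℤ a = mkℤₚ (λ _ → a) (λ _ → mod-refl a)

  fromℕ : ℕ → ℤₚ
  fromℕ n = fromℤ (+ n)

  _+ₚ_ _*ₚ_ : ℤₚ → ℤₚ → ℤₚ
  x +ₚ y = mkℤₚ (λ n → res x n ℤ.+ res y n)
    (λ n → mod-+ (res x (suc n)) (res x n) (res y (suc n)) (res y n) (coherent x n) (coherent y n))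
  x *ₚ y = mkℤₚ (λ n → res x n ℤ.* res y n)
    (λ n → mod-* (res x (suc n)) (res x n) (res y (suc n)) (res y n) (coherent x n) (coherent y n))

  -ₚ_ : ℤₚ → ℤₚ
  -ₚ x = mkℤₚ (λ n → ℤ.- res x n) (λ n → mod-neg (res x (suc n)) (res x n) (coherent x n))

  p^_ : ℕ → ℤₚ
  p^ k = fromℕ (p ℕ.^ k)

  -- The coset x + p^α ℤₚ.
  Ball : ℤₚ → ℕ → Pred ℤₚ 0ℓ
  Ball x α y = res y α ≡ res x α [mod p ℕ.^ α ]

  ----------------------------------------------------------------------
  -- ℚₚ = ℤₚ[1/p]; x /p^ k stands for x / p^k.

  record ℚₚ : Set where
    constructor _/p^_
    field
      num : ℤₚ
      exp : ℕ

  ℚₚ-rawRing : RawRing 0ℓ 0ℓ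
  ℚₚ-rawRing = record
    { Carrier = ℚₚ
    ; _≈_     = λ (x /p^ k) (y /p^ l) → x *ₚ p^ l ≈ₚ y *ₚ p^ k
    ; _+_     = λ (x /p^ k) (y /p^ l) → (x *ₚ p^ l +ₚ y *ₚ p^ k) /p^ (k ℕ.+ l)
    ; _*_     = λ (x /p^ k) (y /p^ l) → (x *ₚ y) /p^ (k ℕ.+ l)
    ; -_      = λ (x /p^ k) → (-ₚ x) /p^ k
    ; 0#      = fromℕ 0 /p^ 0
    ; 1#      = fromℕ 1 /p^ 0
    }

  module ℚₚ-ring = RawRing ℚₚ-rawRing

  -- ratio c α = c / p^α.
  ratio : ℕ → ℕ → ℝ
  ratio c α = fromℚ (ℚ._/_ (+ c) (p ℕ.^ α) {{ℕ.m^n≢0 p α}})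

  -- The graph of the p-adic absolute value: ∣0∣ = 0 and, for u ∈ ℤₚ not
  -- divisible by p, ∣(p^k u) / p^l∣ = p^l / p^k.
  data ∣_∣ₚ≡_ : ℚₚ → ℝ → Set where
    abs-zero    : ∀ {x} → x ℚₚ-ring.≈ ℚₚ-ring.0# → ∣ x ∣ₚ≡ 0ℝ
    abs-nonzero : ∀ {x} (u : ℤₚ) (k l : ℕ) →
                  ¬ (res u 1 ≡ + 0 [mod p ℕ.^ 1 ]) →
                  x ℚₚ-ring.≈ ((p^ k *ₚ u) /p^ l) →
                  ∣ x ∣ₚ≡ ratio (p ℕ.^ l) k

  ----------------------------------------------------------------------

  record FiniteExtension : Set₁ where
    field
      commutativeRing : CommutativeRing 0ℓ 0ℓ
    open CommutativeRing commutativeRing public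
    open RawMonoidDefs +-rawMonoid using (sum)
    field
      1≉0         : ¬ (1# ≈ 0#)
      inverse     : ∀ x → ¬ (x ≈ 0#) → ∃[ y ] (x * y ≈ 1#)
      embed       : ℚₚ → Carrier
      embed-hom   : IsRingHomomorphism ℚₚ-rawRing rawRing embed
      size        : ℕ
      generator   : Fin size → Carrier
      generates   : ∀ x → Σ[ a ∈ (Fin size → ℚₚ) ] (x ≈ sum (λ j → embed (a j) * generator j))

    ι : ℤₚ → Carrier
    ι x = embed (x /p^ 0)

  -- Absolute values extending the p-adic one (there is exactly one on
  -- each finite extension).
  record AbsoluteValue (K : FiniteExtension) : Set where
    open FiniteExtension K
    field
      abs          : Carrier → ℝ
      abs-cong     : ∀ {x y} → x ≈ y → abs x Real.≈ abs y
      abs-nonneg   : ∀ x → 0ℝ Real.≤ abs x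
      abs-0        : ∀ {x} → x ≈ 0# → abs x Real.≈ 0ℝ
      abs-definite : ∀ {x} → abs x Real.≈ 0ℝ → x ≈ 0#
      abs-*        : ∀ x y → abs (x * y) Real.≈ abs x Real.* abs y
      abs-triangle : ∀ x y → abs (x + y) Real.≤ abs x Real.+ abs y
      abs-extends  : ∀ {x r} → ∣ x ∣ₚ≡ r → abs (embed x) Real.≈ r

  ----------------------------------------------------------------------

  IsOpen : Pred ℤₚ 0ℓ → Set
  IsOpen U = ∀ {x} → x ∈ U → ∃[ α ] (Ball x α ⊆ U)

  data IsBorel : Pred ℤₚ 0ℓ → Set₁ where
    open-set   : ∀ {U} → IsOpen U → IsBorel U
    complement : ∀ {E} → IsBorel E → IsBorel (∁ E)
    union      : ∀ {E : ℕ → Pred ℤₚ 0ℓ} → (∀ n → IsBorel (E n)) → IsBorel (⋃ ℕ E)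
    respects   : ∀ {E F} → E ≐ F → IsBorel E → IsBorel F

  translate : ℤₚ → Pred ℤₚ 0ℓ → Pred ℤₚ 0ℓ
  translate a E x = ∃[ y ] (y ∈ E × x ≈ₚ a +ₚ y)

  record HaarMeasure : Set₁ where
    field
      μ           : (E : Pred ℤₚ 0ℓ) → IsBorel E → ℝ
      μ-cong      : ∀ {E F} (bE : IsBorel E) (bF : IsBorel F) → E ≐ F → μ E bE Real.≈ μ F bF
      μ-nonneg    : ∀ {E} (bE : IsBorel E) → 0ℝ Real.≤ μ E bE
      μ-additive  : ∀ {E : ℕ → Pred ℤₚ 0ℓ} (bE : ∀ n → IsBorel (E n)) (b∪ : IsBorel (⋃ ℕ E)) →
                    (∀ {m n} → m ≢ n → E m ⊥ E n) →
                    partialSum (λ n → μ (E n) (bE n)) ⟶ μ (⋃ ℕ E) b∪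
      μ-invariant : ∀ a {E} (bE : IsBorel E) (b+ : IsBorel (translate a E)) →
                    μ (translate a E) b+ Real.≈ μ E bE
      μ-ball      : ∀ m α (b : IsBorel (Ball m α)) → μ (Ball m α) b Real.≈ ratio 1 α

  ----------------------------------------------------------------------

  A : ∀ {M q} → Fin M → Fin q → Pred ℕ 0ℓ
  A {M} {q} i r m = (+ m ≡ + toℕ i [mod M ]) × (+ m ≡ + toℕ r [mod q ])

  residues : (ℕ → ℤₚ) → ∀ α → Pred (Fin (p ℕ.^ α)) 0ℓ
  residues s α a = ∃[ n ] (res (s n) α ≡ + toℕ a [mod p ℕ.^ α ])

  module _ (K : FiniteExtension) (absK : AbsoluteValue K) where
    open FiniteExtension K
    open AbsoluteValue absK

    Continuous : (ℤₚ → Carrier) → Set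
    Continuous g = ∀ x ε → 0ℝ Real.< ε →
      ∃[ δ ] (0ℝ Real.< δ × (∀ y → abs (ι y - ι x) Real.< δ → abs (g y - g x) Real.< ε))

    -- Used with M = p^f - 1.
    record ApproximateTwistedInterpolation {M q : ℕ} (s : ℕ → ℤₚ)
           (σ : Fin M → Fin q → ℤₚ → Carrier) : Set where
      field
        continuous : ∀ i r → Continuous (σ i r)
        C D        : ℝ
        0≤C        : 0ℝ Real.≤ C
        0≤D        : 0ℝ Real.≤ D
        D<1        : D Real.< 1ℝ
        approx     : ∀ i r n → n ∈ A i r →
                     abs (ι (s n) - σ i r (fromℕ n)) Real.≤ C Real.* (D Real.^ n)

  -- ℤₚ ∩ ⋃_{i,r} σ_{i,r}(r + qℤₚ), as a subset of ℤₚ.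
  limitSet : (K : FiniteExtension) → let open FiniteExtension K in
             ∀ {M q} → (Fin M → Fin q → ℤₚ → Carrier) → Pred ℤₚ 0ℓ
  limitSet K {M} {q} σ x = ∃[ i ] ∃[ r ] ∃[ y ] (ι x ≈ σ i r (fromℕ (toℕ r) +ₚ fromℕ q *ₚ y))
    where open FiniteExtension K

{-# OPTIONS --safe #-}
module Submission where

open import Algebra.Morphism.Structures using (module IsRingHomomorphism)
import Algebra.Properties.Group as GroupProperties
import Algebra.Properties.Ring as RingProperties
open import Axiom.ExcludedMiddle using (ExcludedMiddle)
open import Data.Fin.Base as Fin using (Fin; toℕ)
import Data.Fin.Properties as Fin
open import Data.Integer.Base as ℤ using (ℤ; +_; +≤+; +<+)
import Data.Integer.DivMod as ℤ
open import Data.Integer.Divisibility.Signed using (_∣_; divides; ∣-trans; ∣⇒∣ᵤ; ∣m∣n⇒∣m+n; ∣m⇒∣-m; ∣n⇒∣m*n; ∣m⇒∣m*n; *-cancelʳ-∣; *-monoˡ-∣)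
import Data.Integer.Properties as ℤ
open import Data.Integer.Solver using () renaming (module +-*-Solver to ℤ-Solver)
open import Data.List.Base using (List; []; _∷_; length; filter; allFin; upTo)
import Data.List.Membership.Propositional as List
open import Data.List.Membership.Propositional.Properties using (∈-filter⁺; ∈-filter⁻; ∈-allFin; ∈-upTo⁺)
open import Data.List.Properties using (length-upTo)
open import Data.List.Relation.Unary.All as All using (All)
open import Data.List.Relation.Unary.AllPairs as AllPairs using (AllPairs)
open import Data.List.Relation.Unary.Any as Any using (Any; here; there)
open import Data.List.Relation.Unary.Unique.Propositional.Properties using (allFin⁺; filter⁺)
open import Data.Nat.Base as ℕ using (ℕ; zero; suc; _≤_; _∸_; _^_)
import Data.Nat.Divisibility as ℕ
open import Data.Nat.Primality using (Prime; prime⇒nonZero; prime⇒nonTrivial)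
import Data.Nat.Properties as ℕ
open import Data.Nat.Solver using () renaming (module +-*-Solver to ℕ-Solver)
open import Data.Product.Base using (∃-syntax; Σ-syntax; _×_; _,_; proj₁; proj₂)
open import Data.Rational.Base as ℚ using (ℚ; 0ℚ; 1ℚ; ½)
import Data.Rational.Properties as ℚ
open import Data.Rational.Solver using () renaming (module +-*-Solver to ℚ-Solver)
import Data.Rational.Unnormalised.Base as ℚᵘ
import Data.Rational.Unnormalised.Properties as ℚᵘ
open import Data.Sum.Base using (_⊎_; inj₁; inj₂)
open import Data.Unit.Base using (⊤; tt)
open import Level using (0ℓ)
open import Relation.Binary.Definitions using (tri<; tri≈; tri>)
open import Relation.Binary.PropositionalEquality using (_≡_; _≢_; refl; sym; trans; cong; cong₂; subst; subst₂)
import Relation.Binary.Reasoning.Setoid as SetoidReasoning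
open import Relation.Nullary using (¬_; Dec; yes; no; contradiction)
open import Relation.Nullary.Decidable using (decidable-stable)
open import Relation.Unary using (Pred; _∈_; _∉_; _⊆_; _≐_; _⊥_; _∪_; _∩_; _∖_; ∁; ⋃; ∅)
open import Defs
open Real using (ℝ; seq; cauchy; fromℚ; 0ℝ; 1ℝ; partialSum; _⟶_)

-- Let L be the limit set, S = {s(n)}, and write X_α for the union of the cosets of p^α ℤₚ that
-- meet X, so that the α-th term of the sequence is μ(S_α).
-- (1) L is closed, and for each β all but finitely many s(n) lie in L_β.  Both are sequential
--     compactness: if ι(x_n) - σ_{i_n,r_n}(r_n + q y_n) → 0, pass to a subsequence on which i_n and
--     r_n are constant and y_n converges; then x_n is Cauchy, and its limit is in L.
-- (2) L ⊆ S_α: for x = σ_{i,r}(w), the Chinese remainder theorem yields a large n ∈ A_{i,r}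
--     close to w, and then s(n) ≈ σ_{i,r}(n) ≈ x.
-- (3) By (1) and (2), μ(L) ≤ μ(S_α) ≤ μ(L_β) + N_β / p^α for α ≥ β, and μ(L_β) → μ(L) because
--     L_0 is the disjoint union of L and the shells L_n ∖ L_{n+1}.

-- Rational numbers

-- The limit in (1) is a value c = σ(w) known before any limit is taken; what must be shown is that
-- c lies in the image of ι. The absolute value of K restricts on ι(ℤₚ) to the p-adic one, so |ι x -
-- ι y| ≤ 1/p^k says exactly that x and y are congruent modulo p^k; points close to c therefore have
-- matching residues, which assemble into a p-adic integer. Distances are combined by the ordinary
-- triangle inequality, so each change of base point costs a factor 2, paid for by one power of p.
-- In (2), membership in A_{i,r} is two congruences of different nature. As q is a power of p, n ≡ r
-- modulo q follows once n is p-adically close to w in r + qℤₚ; as p^f - 1 is prime to p, the class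
-- modulo p^f - 1 can be prescribed independently of that closeness. In (3), N_β does not depend on
-- α, so β is fixed first and α tends to infinity afterwards.

½-pos : ∀ {ε} → 0ℚ ℚ.< ε → 0ℚ ℚ.< ½ ℚ.* ε
½-pos {ε} 0<ε = subst (ℚ._< ½ ℚ.* ε) (ℚ.*-zeroʳ ½) (ℚ.*-monoʳ-<-pos ½ 0<ε)

½+½ : ∀ ε → ½ ℚ.* ε ℚ.+ ½ ℚ.* ε ≡ ε
½+½ ε = trans (sym (ℚ.*-distribʳ-+ ε ½ ½)) (ℚ.*-identityˡ ε)

+-cancelʳ-< : ∀ c {a b} → a ℚ.+ c ℚ.< b ℚ.+ c → a ℚ.< b
+-cancelʳ-< c {a} {b} h = subst₂ ℚ._<_ (lem a) (lem b) (ℚ.+-monoˡ-< (ℚ.- c) h)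
  where
  open ℚ-Solver
  lem : ∀ a → (a ℚ.+ c) ℚ.- c ≡ a
  lem a = solve 2 (λ a c → (a :+ c) :- c := a) refl a c

p<p+q : ∀ p {q} → 0ℚ ℚ.< q → p ℚ.< p ℚ.+ q
p<p+q p {q} 0<q = subst (ℚ._< p ℚ.+ q) (ℚ.+-identityʳ p) (ℚ.+-monoʳ-< p 0<q)

p≤∣p∣ : ∀ p → p ℚ.≤ ℚ.∣ p ∣
p≤∣p∣ p with ℚ.≤-total 0ℚ p
... | inj₁ 0≤p = ℚ.≤-reflexive (sym (ℚ.0≤p⇒∣p∣≡p 0≤p))
... | inj₂ p≤0 = ℚ.≤-trans p≤0 (ℚ.nonNegative⁻¹ ℚ.∣ p ∣ {{ℚ.∣-∣-nonNeg p}})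

∣p∣<q : ∀ {p q} → p ℚ.< q → ℚ.- p ℚ.< q → ℚ.∣ p ∣ ℚ.< q
∣p∣<q {p} {q} p<q -p<q with ℚ.∣p∣≡p∨∣p∣≡-p p
... | inj₁ e = subst (ℚ._< q) (sym e) p<q
... | inj₂ e = subst (ℚ._< q) (sym e) -p<q

∣p∣≤q : ∀ {p q} → p ℚ.≤ q → ℚ.- p ℚ.≤ q → ℚ.∣ p ∣ ℚ.≤ q
∣p∣≤q {p} {q} p≤q -p≤q with ℚ.∣p∣≡p∨∣p∣≡-p p
... | inj₁ e = subst (ℚ._≤ q) (sym e) p≤q
... | inj₂ e = subst (ℚ._≤ q) (sym e) -p≤q

∣p-q∣<r⇒p<q+r : ∀ p q {r} → ℚ.∣ p ℚ.- q ∣ ℚ.< r → p ℚ.< q ℚ.+ r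
∣p-q∣<r⇒p<q+r p q {r} h = subst (ℚ._< q ℚ.+ r)
  (solve 2 (λ p q → q :+ (p :- q) := p) refl p q)
  (ℚ.+-monoʳ-< q (ℚ.≤-<-trans (p≤∣p∣ (p ℚ.- q)) h))
  where open ℚ-Solver

∣p-q∣<r⇒q<p+r : ∀ p q {r} → ℚ.∣ p ℚ.- q ∣ ℚ.< r → q ℚ.< p ℚ.+ r
∣p-q∣<r⇒q<p+r p q {r} h = ∣p-q∣<r⇒p<q+r q p (subst (ℚ._< r)
  (trans (sym (ℚ.∣-p∣≡∣p∣ (p ℚ.- q))) (cong ℚ.∣_∣ (solve 2 (λ p q → :- (p :- q) := q :- p) refl p q))) h)
  where open ℚ-Solver

p<q+r⇒p-q<r : ∀ p q {r} → p ℚ.< q ℚ.+ r → p ℚ.- q ℚ.< r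
p<q+r⇒p-q<r p q {r} h = subst (p ℚ.- q ℚ.<_)
  (solve 2 (λ q r → (q :+ r) :- q := r) refl q r) (ℚ.+-monoˡ-< (ℚ.- q) h)
  where open ℚ-Solver

∣p-q∣<r : ∀ p q {r} → p ℚ.< q ℚ.+ r → q ℚ.< p ℚ.+ r → ℚ.∣ p ℚ.- q ∣ ℚ.< r
∣p-q∣<r p q {r} h k = ∣p∣<q (p<q+r⇒p-q<r p q h)
  (subst (ℚ._< r) (solve 2 (λ p q → q :- p := :- (p :- q)) refl p q) (p<q+r⇒p-q<r q p k))
  where open ℚ-Solver

divide : ∀ B .{{_ : ℚ.Positive B}} {ε} → 0ℚ ℚ.< ε → ∃[ δ ] (0ℚ ℚ.< δ × B ℚ.* δ ≡ ε)
divide B {ε} 0<ε = B⁻¹ ℚ.* ε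
  , subst (ℚ._< B⁻¹ ℚ.* ε) (ℚ.*-zeroʳ B⁻¹) (ℚ.*-monoʳ-<-pos B⁻¹ {{ℚ.1/pos⇒pos B}} 0<ε)
  , trans (sym (ℚ.*-assoc B B⁻¹ ε))
      (trans (cong (ℚ._* ε) (ℚ.*-inverseʳ B {{ℚ.pos⇒nonZero B}})) (ℚ.*-identityˡ ε))
  where
  B⁻¹ : ℚ
  B⁻¹ = ℚ.1/_ B {{ℚ.pos⇒nonZero B}}

infixl 7 _÷_
_÷_ : (a b : ℕ) .{{_ : ℕ.NonZero b}} → ℚ
a ÷ b = + a ℚ./ b

÷-mono-≤ : ∀ a b c d .{{_ : ℕ.NonZero b}} .{{_ : ℕ.NonZero d}} → a ℕ.* d ℕ.≤ c ℕ.* b → a ÷ b ℚ.≤ c ÷ d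
÷-mono-≤ a (suc b) c (suc d) h = ℚ.toℚᵘ-cancel-≤ (begin
  ℚ.toℚᵘ (a ÷ suc b)      ≃⟨ ℚ.toℚᵘ-fromℚᵘ (ℚᵘ.mkℚᵘ (+ a) b) ⟩
  ℚᵘ.mkℚᵘ (+ a) b         ≤⟨ ℚᵘ.*≤* (subst₂ ℤ._≤_ (ℤ.pos-* a (suc d)) (ℤ.pos-* c (suc b)) (+≤+ h)) ⟩
  ℚᵘ.mkℚᵘ (+ c) d         ≃⟨ ℚᵘ.≃-sym (ℚ.toℚᵘ-fromℚᵘ (ℚᵘ.mkℚᵘ (+ c) d)) ⟩
  ℚ.toℚᵘ (c ÷ suc d)      ∎)
  where open ℚᵘ.≤-Reasoning

÷-mono-< : ∀ a b c d .{{_ : ℕ.NonZero b}} .{{_ : ℕ.NonZero d}} → a ℕ.* d ℕ.< c ℕ.* b → a ÷ b ℚ.< c ÷ d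
÷-mono-< a (suc b) c (suc d) h = ℚ.toℚᵘ-cancel-< (begin-strict
  ℚ.toℚᵘ (a ÷ suc b)      ≃⟨ ℚ.toℚᵘ-fromℚᵘ (ℚᵘ.mkℚᵘ (+ a) b) ⟩
  ℚᵘ.mkℚᵘ (+ a) b         <⟨ ℚᵘ.*<* (subst₂ ℤ._<_ (ℤ.pos-* a (suc d)) (ℤ.pos-* c (suc b)) (+<+ h)) ⟩
  ℚᵘ.mkℚᵘ (+ c) d         ≃⟨ ℚᵘ.≃-sym (ℚ.toℚᵘ-fromℚᵘ (ℚᵘ.mkℚᵘ (+ c) d)) ⟩
  ℚ.toℚᵘ (c ÷ suc d)      ∎)
  where open ℚᵘ.≤-Reasoning

÷-+ : ∀ a c b .{{_ : ℕ.NonZero b}} → a ÷ b ℚ.+ c ÷ b ≡ (a ℕ.+ c) ÷ b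
÷-+ a c (suc b) = ℚ.toℚᵘ-injective (begin
  ℚ.toℚᵘ (a ÷ suc b ℚ.+ c ÷ suc b)
    ≈⟨ ℚ.toℚᵘ-homo-+ (a ÷ suc b) (c ÷ suc b) ⟩
  ℚ.toℚᵘ (a ÷ suc b) ℚᵘ.+ ℚ.toℚᵘ (c ÷ suc b)
    ≈⟨ ℚᵘ.+-cong (ℚ.toℚᵘ-fromℚᵘ (ℚᵘ.mkℚᵘ (+ a) b)) (ℚ.toℚᵘ-fromℚᵘ (ℚᵘ.mkℚᵘ (+ c) b)) ⟩
  ℚᵘ.mkℚᵘ (+ a) b ℚᵘ.+ ℚᵘ.mkℚᵘ (+ c) b
    ≈⟨ ℚᵘ.*≡* (trans (cong (ℤ._* + suc b) (sym (ℤ.*-distribʳ-+ (+ suc b) (+ a) (+ c))))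
         (trans (ℤ.*-assoc (+ (a ℕ.+ c)) (+ suc b) (+ suc b))
           (cong (+ (a ℕ.+ c) ℤ.*_) (sym (ℤ.pos-* (suc b) (suc b)))))) ⟩
  ℚᵘ.mkℚᵘ (+ (a ℕ.+ c)) b
    ≈⟨ ℚᵘ.≃-sym (ℚ.toℚᵘ-fromℚᵘ (ℚᵘ.mkℚᵘ (+ (a ℕ.+ c)) b)) ⟩
  ℚ.toℚᵘ ((a ℕ.+ c) ÷ suc b) ∎)
  where open SetoidReasoning ℚᵘ.≃-setoid

-- A positive fraction has numerator at least 1, so its own denominator serves.
archimedean : ∀ {ε} → 0ℚ ℚ.< ε → ∃[ d ] (1 ÷ suc d ℚ.≤ ε)
archimedean {ε@(ℚ.mkℚ (+ suc n) d _)} 0<ε = d , ℚ.toℚᵘ-cancel-≤ (begin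
  ℚ.toℚᵘ (1 ÷ suc d)   ≃⟨ ℚ.toℚᵘ-fromℚᵘ (ℚᵘ.mkℚᵘ (+ 1) d) ⟩
  ℚᵘ.mkℚᵘ (+ 1) d      ≤⟨ ℚᵘ.*≤* (ℤ.*-monoʳ-≤-nonNeg (+ suc d) {+ 1} {+ suc n} (+≤+ (ℕ.s≤s ℕ.z≤n))) ⟩
  ℚ.toℚᵘ ε             ∎)
  where open ℚᵘ.≤-Reasoning
archimedean {ℚ.mkℚ (+ 0) d _} (ℚ.*<* (+<+ ()))
archimedean {ℚ.mkℚ ℤ.-[1+ n ] d _} (ℚ.*<* ())

-- Real numbers

-- Real._≤_ unfolds to a function type, from which Agda cannot recover its arguments;
-- the record keeps them inferable.
infix 4 _≤ᴿ_
record _≤ᴿ_ (x y : ℝ) : Set where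
  constructor wrap
  field unwrap : x Real.≤ y

open _≤ᴿ_ public

eventually₂ : ∀ {P Q : ℕ → Set} → ∃[ N ] (∀ n → N ℕ.≤ n → P n) → ∃[ N ] (∀ n → N ℕ.≤ n → Q n) →
  ∃[ N ] (∀ n → N ℕ.≤ n → P n × Q n)
eventually₂ (M , h) (N , k) = M ℕ.⊔ N , λ n n≥ →
  h n (ℕ.m⊔n≤o⇒m≤o M N n≥) , k n (ℕ.m⊔n≤o⇒n≤o M N n≥)

≗⇒≤ : ∀ {x y} → (∀ n → seq x n ≡ seq y n) → x ≤ᴿ y
≗⇒≤ {x} {y} e = wrap λ ε 0<ε → 0 , λ n _ → subst (ℚ._< seq y n ℚ.+ ε) (sym (e n)) (p<p+q (seq y n) 0<ε)

≤-refl : ∀ {x} → x ≤ᴿ x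
≤-refl = ≗⇒≤ (λ _ → refl)

≈⇒≤ : ∀ {x y} → x Real.≈ y → x ≤ᴿ y
≈⇒≤ {x} {y} e = wrap λ ε 0<ε → let N , h = e ε 0<ε in N , λ n n≥ → ∣p-q∣<r⇒p<q+r (seq x n) (seq y n) (h n n≥)

≈⇒≥ : ∀ {x y} → x Real.≈ y → y ≤ᴿ x
≈⇒≥ {x} {y} e = wrap λ ε 0<ε → let N , h = e ε 0<ε in N , λ n n≥ → ∣p-q∣<r⇒q<p+r (seq x n) (seq y n) (h n n≥)

≤-antisym : ∀ {x y} → x ≤ᴿ y → y ≤ᴿ x → x Real.≈ y
≤-antisym {x} {y} (wrap h) (wrap k) ε 0<ε = let N , l = eventually₂ (h ε 0<ε) (k ε 0<ε) in
  N , λ n n≥ → ∣p-q∣<r (seq x n) (seq y n) (proj₁ (l n n≥)) (proj₂ (l n n≥))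

≤-trans : ∀ {x y z} → x ≤ᴿ y → y ≤ᴿ z → x ≤ᴿ z
≤-trans {x} {y} {z} (wrap h) (wrap k) = wrap λ ε 0<ε →
  let N , l = eventually₂ (h (½ ℚ.* ε) (½-pos 0<ε)) (k (½ ℚ.* ε) (½-pos 0<ε))
      open ℚ.≤-Reasoning
  in N , λ n n≥ → begin-strict
    seq x n                               <⟨ proj₁ (l n n≥) ⟩
    seq y n ℚ.+ ½ ℚ.* ε                   <⟨ ℚ.+-monoˡ-< (½ ℚ.* ε) (proj₂ (l n n≥)) ⟩
    seq z n ℚ.+ ½ ℚ.* ε ℚ.+ ½ ℚ.* ε       ≡⟨ ℚ.+-assoc (seq z n) (½ ℚ.* ε) (½ ℚ.* ε) ⟩
    seq z n ℚ.+ (½ ℚ.* ε ℚ.+ ½ ℚ.* ε)     ≡⟨ cong (seq z n ℚ.+_) (½+½ ε) ⟩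
    seq z n ℚ.+ ε                         ∎

<⇒≤ : ∀ {x y} → x Real.< y → x ≤ᴿ y
<⇒≤ {x} {y} (ε , 0<ε , N , h) = wrap λ δ 0<δ → N , λ n n≥ →
  ℚ.<-trans (p<p+q (seq x n) 0<ε) (ℚ.<-trans (h n n≥) (p<p+q (seq y n) 0<δ))

+-mono-≤ : ∀ {x y z w} → x ≤ᴿ y → z ≤ᴿ w → x Real.+ z ≤ᴿ y Real.+ w
+-mono-≤ {x} {y} {z} {w} (wrap h) (wrap k) = wrap λ ε 0<ε →
  let N , l = eventually₂ (h (½ ℚ.* ε) (½-pos 0<ε)) (k (½ ℚ.* ε) (½-pos 0<ε))
      open ℚ.≤-Reasoning
      open ℚ-Solver
  in N , λ n n≥ → begin-strict
    seq x n ℚ.+ seq z n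
      <⟨ ℚ.+-mono-< (proj₁ (l n n≥)) (proj₂ (l n n≥)) ⟩
    (seq y n ℚ.+ ½ ℚ.* ε) ℚ.+ (seq w n ℚ.+ ½ ℚ.* ε)
      ≡⟨ solve 3 (λ a b e → (a :+ e) :+ (b :+ e) := (a :+ b) :+ (e :+ e)) refl (seq y n) (seq w n) (½ ℚ.* ε) ⟩
    (seq y n ℚ.+ seq w n) ℚ.+ (½ ℚ.* ε ℚ.+ ½ ℚ.* ε)
      ≡⟨ cong (seq y n ℚ.+ seq w n ℚ.+_) (½+½ ε) ⟩
    seq y n ℚ.+ seq w n ℚ.+ ε ∎

+-monoˡ-≤ : ∀ {x y} z → x ≤ᴿ y → x Real.+ z ≤ᴿ y Real.+ z
+-monoˡ-≤ {x} {y} z h = +-mono-≤ {x} {y} {z} {z} h ≤-refl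

fromℚ-mono-≤ : ∀ {a b} → a ℚ.≤ b → fromℚ a ≤ᴿ fromℚ b
fromℚ-mono-≤ {a} {b} h = wrap λ ε 0<ε → 0 , λ _ _ → ℚ.≤-<-trans h (p<p+q b 0<ε)

fromℚ-cancel-≤ : ∀ {a b} → fromℚ a ≤ᴿ fromℚ b → a ℚ.≤ b
fromℚ-cancel-≤ {a} {b} (wrap h) with a ℚ.≤? b
... | yes a≤b = a≤b
... | no  a≰b = contradiction (k N ℕ.≤-refl) (ℚ.<-irrefl (solve 2 (λ a b → a := b :+ (a :- b)) refl a b))
  where
  open ℚ-Solver
  0<a-b : 0ℚ ℚ.< a ℚ.- b
  0<a-b = subst (ℚ._< a ℚ.- b) (ℚ.+-inverseʳ b) (ℚ.+-monoˡ-< (ℚ.- b) (ℚ.≰⇒> a≰b))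
  N = proj₁ (h (a ℚ.- b) 0<a-b)
  k = proj₂ (h (a ℚ.- b) 0<a-b)

+-fromℚ-≤ : ∀ {x y a b c} → x ≤ᴿ fromℚ a → y ≤ᴿ fromℚ b → a ℚ.+ b ℚ.≤ c → x Real.+ y ≤ᴿ fromℚ c
+-fromℚ-≤ {x} {y} {a} {b} {c} h k a+b≤c = ≤-trans {y = fromℚ a Real.+ fromℚ b} (+-mono-≤ {x} {fromℚ a} {y} {fromℚ b} h k)
  (≤-trans {y = fromℚ (a ℚ.+ b)} (≗⇒≤ (λ _ → refl)) (fromℚ-mono-≤ a+b≤c))

fromℚ-pos : ∀ {a} → 0ℚ ℚ.< a → 0ℝ Real.< fromℚ a
fromℚ-pos {a} 0<a = ½ ℚ.* a , ½-pos 0<a , 0 , λ _ _ →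
  subst₂ ℚ._<_ (sym (ℚ.+-identityˡ (½ ℚ.* a))) (½+½ a) (p<p+q (½ ℚ.* a) (½-pos 0<a))

≤-fromℚ-closed : ∀ {x y} → (∀ δ → 0ℚ ℚ.< δ → x ≤ᴿ y Real.+ fromℚ δ) → x ≤ᴿ y
≤-fromℚ-closed {x} {y} h = wrap λ ε 0<ε →
  let N , k = unwrap (h (½ ℚ.* ε) (½-pos 0<ε)) (½ ℚ.* ε) (½-pos 0<ε)
  in N , λ n n≥ → subst (seq x n ℚ.<_)
    (trans (ℚ.+-assoc (seq y n) (½ ℚ.* ε) (½ ℚ.* ε)) (cong (seq y n ℚ.+_) (½+½ ε))) (k n n≥)

-- Convergence is defined with real ε. This lemma and its converse replace it by two inequalities
-- with rational errors, so that the measure theory needs only `_≤ᴿ_`.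
⟶⇒≤ : ∀ {x l} → x ⟶ l → ∀ δ → 0ℚ ℚ.< δ →
  ∃[ N ] (∀ n → N ℕ.≤ n → x n ≤ᴿ l Real.+ fromℚ δ × l ≤ᴿ x n Real.+ fromℚ δ)
⟶⇒≤ {x} {l} h δ 0<δ = let N , k = h (fromℚ δ) (fromℚ-pos 0<δ) in N , λ n n≥ →
  let (ε , 0<ε , M , g) = k n n≥
      near : ∀ m → M ℕ.≤ m → ℚ.∣ seq (x n) m ℚ.- seq l m ∣ ℚ.< δ
      near m m≥ = ℚ.<-trans (p<p+q _ 0<ε) (g m m≥)
  in wrap (λ η 0<η → M , λ m m≥ → ℚ.<-trans (∣p-q∣<r⇒p<q+r (seq (x n) m) (seq l m) (near m m≥)) (p<p+q _ 0<η))
   , wrap (λ η 0<η → M , λ m m≥ → ℚ.<-trans (∣p-q∣<r⇒q<p+r (seq (x n) m) (seq l m) (near m m≥)) (p<p+q _ 0<η))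

≤⇒⟶ : ∀ {x l} → (∀ δ → 0ℚ ℚ.< δ →
  ∃[ N ] (∀ n → N ℕ.≤ n → x n ≤ᴿ l Real.+ fromℚ δ × l ≤ᴿ x n Real.+ fromℚ δ)) → x ⟶ l
≤⇒⟶ {x} {l} h ε (η , 0<η , M , g) =
  -- Below the real ε lies the rational η. The hypothesis uses η/4 and the slack in `_≤ᴿ_` another
  -- η/4; the remaining η/2 is the gap that a strict inequality must exhibit.
  let η/2 = ½ ℚ.* η
      η/4 = ½ ℚ.* η/2
      0<η/2 = ½-pos 0<η
      0<η/4 = ½-pos 0<η/2
      N , k = h η/4 0<η/4
  in N , λ n n≥ →
    let K , e = eventually₂ (unwrap (proj₁ (k n n≥)) η/4 0<η/4) (unwrap (proj₂ (k n n≥)) η/4 0<η/4)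
        sum : ∀ a → a ℚ.+ η/4 ℚ.+ η/4 ≡ a ℚ.+ η/2
        sum a = trans (ℚ.+-assoc a η/4 η/4) (cong (a ℚ.+_) (½+½ η/2))
    in η/2 , 0<η/2 , K ℕ.⊔ M , λ m m≥ →
      let up , lo = e m (ℕ.m⊔n≤o⇒m≤o K M m≥)
          open ℚ.≤-Reasoning
      in begin-strict
        ℚ.∣ seq (x n) m ℚ.- seq l m ∣ ℚ.+ η/2
          <⟨ ℚ.+-monoˡ-< η/2 (∣p-q∣<r (seq (x n) m) (seq l m)
               (subst (seq (x n) m ℚ.<_) (sum (seq l m)) up)
               (subst (seq l m ℚ.<_) (sum (seq (x n) m)) lo)) ⟩
        η/2 ℚ.+ η/2          ≡⟨ ½+½ η ⟩
        η                    ≡⟨ sym (ℚ.+-identityˡ η) ⟩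
        0ℚ ℚ.+ η             <⟨ g m (ℕ.m⊔n≤o⇒n≤o K M m≥) ⟩
        seq ε m              ∎

positive-dominates : ∀ {δ} → 0ℝ Real.< δ → ∃[ η ] (0ℚ ℚ.< η × (∀ {x} → x ≤ᴿ fromℚ η → x Real.< δ))
positive-dominates {δ} (ε , 0<ε , N , h) =
  let ε/2 = ½ ℚ.* ε
      ε/4 = ½ ℚ.* ε/2
      0<ε/2 = ½-pos 0<ε
      0<ε/4 = ½-pos 0<ε/2
      open ℚ.≤-Reasoning
  in ε/2 , 0<ε/2 , λ {x} (wrap x≤) → let M , k = eventually₂ (x≤ ε/4 0<ε/4) (N , h) in
    ε/4 , 0<ε/4 , M , λ n n≥ → begin-strict
      seq x n ℚ.+ ε/4             <⟨ ℚ.+-monoˡ-< ε/4 (proj₁ (k n n≥)) ⟩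
      ε/2 ℚ.+ ε/4 ℚ.+ ε/4         ≡⟨ ℚ.+-assoc ε/2 ε/4 ε/4 ⟩
      ε/2 ℚ.+ (ε/4 ℚ.+ ε/4)       ≡⟨ cong (ε/2 ℚ.+_) (½+½ ε/2) ⟩
      ε/2 ℚ.+ ε/2                 ≡⟨ ½+½ ε ⟩
      ε                           ≡⟨ sym (ℚ.+-identityˡ ε) ⟩
      0ℚ ℚ.+ ε                    <⟨ proj₂ (k n n≥) ⟩
      seq δ n                     ∎

bounded : ∀ x → ∃[ B ] (ℚ.Positive B × ∃[ N ] (∀ n → N ℕ.≤ n → ℚ.∣ seq x n ∣ ℚ.≤ B))
bounded x with cauchy x 1ℚ (ℚ.positive⁻¹ 1ℚ)
... | N , h = ℚ.∣ seq x N ∣ ℚ.+ 1ℚ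
    , ℚ.nonNeg+pos⇒pos ℚ.∣ seq x N ∣ {{ℚ.∣-∣-nonNeg (seq x N)}} 1ℚ
    , N , λ n n≥ → begin
      ℚ.∣ seq x n ∣
        ≡⟨ cong ℚ.∣_∣ (solve 2 (λ a b → a := b :+ (a :- b)) refl (seq x n) (seq x N)) ⟩
      ℚ.∣ seq x N ℚ.+ (seq x n ℚ.- seq x N) ∣
        ≤⟨ ℚ.∣p+q∣≤∣p∣+∣q∣ (seq x N) (seq x n ℚ.- seq x N) ⟩
      ℚ.∣ seq x N ∣ ℚ.+ ℚ.∣ seq x n ℚ.- seq x N ∣
        ≤⟨ ℚ.+-monoʳ-≤ ℚ.∣ seq x N ∣ (ℚ.<⇒≤ (h n N n≥ ℕ.≤-refl)) ⟩
      ℚ.∣ seq x N ∣ ℚ.+ 1ℚ ∎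
  where
  open ℚ.≤-Reasoning
  open ℚ-Solver

-- Needed for x = |-1|, in the symmetry of `Near`. The error (x - 1)y tends to 0 because the
-- sequence of y is bounded.
≈1⇒*-≤ : ∀ {x} y → x Real.≈ 1ℝ → x Real.* y ≤ᴿ y
≈1⇒*-≤ {x} y x≈1 = wrap λ ε 0<ε →
  let B , B>0 , M , hB = bounded y
      δ , 0<δ , Bδ = divide B {{B>0}} 0<ε
      N , h = eventually₂ (x≈1 δ 0<δ) (M , hB)
      open ℚ.≤-Reasoning
      open ℚ-Solver
  in N , λ n n≥ → ∣p-q∣<r⇒p<q+r (seq x n ℚ.* seq y n) (seq y n) (begin-strict
    ℚ.∣ seq x n ℚ.* seq y n ℚ.- seq y n ∣
      ≡⟨ cong ℚ.∣_∣ (solve 2 (λ a b → a :* b :- b := b :* (a :- con (+ 1 ℚ./ 1))) refl (seq x n) (seq y n)) ⟩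
    ℚ.∣ seq y n ℚ.* (seq x n ℚ.- 1ℚ) ∣
      ≡⟨ ℚ.∣p*q∣≡∣p∣*∣q∣ (seq y n) (seq x n ℚ.- 1ℚ) ⟩
    ℚ.∣ seq y n ∣ ℚ.* ℚ.∣ seq x n ℚ.- 1ℚ ∣
      ≤⟨ ℚ.*-monoʳ-≤-nonNeg ℚ.∣ seq x n ℚ.- 1ℚ ∣ {{ℚ.∣-∣-nonNeg (seq x n ℚ.- 1ℚ)}} (proj₂ (h n n≥)) ⟩
    B ℚ.* ℚ.∣ seq x n ℚ.- 1ℚ ∣
      <⟨ ℚ.*-monoʳ-<-pos B {{B>0}} (proj₁ (h n n≥)) ⟩
    B ℚ.* δ
      ≡⟨ Bδ ⟩
    ε ∎)

-- Geometric sequences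

infixr 7 _•_
_•_ : ℕ → ℚ → ℚ
zero  • a = 0ℚ
suc n • a = a ℚ.+ n • a

•-÷ : ∀ n b .{{_ : ℕ.NonZero b}} → n • (1 ÷ b) ≡ n ÷ b
•-÷ zero    (suc b) = sym (ℚ.0/n≡0 (suc b))
•-÷ (suc n) b       = trans (cong (1 ÷ b ℚ.+_) (•-÷ n b)) (÷-+ 1 n b)

•-monoʳ-≤ : ∀ n {a b} → a ℚ.≤ b → n • a ℚ.≤ n • b
•-monoʳ-≤ zero    h = ℚ.≤-refl
•-monoʳ-≤ (suc n) h = ℚ.+-mono-≤ h (•-monoʳ-≤ n h)

•-nonneg : ∀ n {a} → 0ℚ ℚ.≤ a → 0ℚ ℚ.≤ n • a
•-nonneg zero    h = ℚ.≤-refl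
•-nonneg (suc n) h = ℚ.+-mono-≤ h (•-nonneg n h)

•-*ʳ : ∀ n a b → n • (a ℚ.* b) ≡ (n • a) ℚ.* b
•-*ʳ zero    a b = sym (ℚ.*-zeroˡ b)
•-*ʳ (suc n) a b = trans (cong (a ℚ.* b ℚ.+_) (•-*ʳ n a b)) (sym (ℚ.*-distribʳ-+ b a (n • a)))

infixr 8 _^ℚ_
_^ℚ_ : ℚ → ℕ → ℚ
a ^ℚ zero  = 1ℚ
a ^ℚ suc n = a ℚ.* a ^ℚ n

*-nonneg : ∀ {a b} → 0ℚ ℚ.≤ a → 0ℚ ℚ.≤ b → 0ℚ ℚ.≤ a ℚ.* b
*-nonneg {a} {b} ha hb = subst (ℚ._≤ a ℚ.* b) (ℚ.*-zeroˡ b) (ℚ.*-monoʳ-≤-nonNeg b {{ℚ.nonNegative hb}} ha)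

^-nonneg : ∀ {a} n → 0ℚ ℚ.≤ a → 0ℚ ℚ.≤ a ^ℚ n
^-nonneg zero    h = ℚ.nonNegative⁻¹ 1ℚ
^-nonneg (suc n) h = *-nonneg h (^-nonneg n h)

∣∣*-mono-≤ : ∀ {a b c d} → ℚ.∣ a ∣ ℚ.≤ c → ℚ.∣ b ∣ ℚ.≤ d → ℚ.∣ a ℚ.* b ∣ ℚ.≤ c ℚ.* d
∣∣*-mono-≤ {a} {b} {c} {d} h k = begin
  ℚ.∣ a ℚ.* b ∣          ≡⟨ ℚ.∣p*q∣≡∣p∣*∣q∣ a b ⟩
  ℚ.∣ a ∣ ℚ.* ℚ.∣ b ∣    ≤⟨ ℚ.*-monoʳ-≤-nonNeg ℚ.∣ b ∣ {{ℚ.∣-∣-nonNeg b}} h ⟩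
  c ℚ.* ℚ.∣ b ∣          ≤⟨ ℚ.*-monoˡ-≤-nonNeg c {{ℚ.nonNegative (ℚ.≤-trans (ℚ.nonNegative⁻¹ _ {{ℚ.∣-∣-nonNeg a}}) h)}} k ⟩
  c ℚ.* d                ∎
  where open ℚ.≤-Reasoning

∣D^n∣≤ρ^n : ∀ D {ρ} m n → ℚ.∣ seq D m ∣ ℚ.≤ ρ → ℚ.∣ seq (D Real.^ n) m ∣ ℚ.≤ ρ ^ℚ n
∣D^n∣≤ρ^n D m zero    h = ℚ.≤-refl
∣D^n∣≤ρ^n D m (suc n) h = ∣∣*-mono-≤ {seq D m} {seq (D Real.^ n) m} h (∣D^n∣≤ρ^n D m n h)

-- Bernoulli's inequality for 1/(1 - θ), without division.
bernoulli : ∀ θ n → 0ℚ ℚ.≤ θ → 0ℚ ℚ.≤ 1ℚ ℚ.- θ → (1ℚ ℚ.- θ) ^ℚ n ℚ.* (1ℚ ℚ.+ n • θ) ℚ.≤ 1ℚ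
bernoulli θ zero    _   _   = ℚ.≤-refl
bernoulli θ (suc n) 0≤θ 0≤ρ = begin
  (ρ ℚ.* ρ ^ℚ n) ℚ.* (1ℚ ℚ.+ (θ ℚ.+ m))
    ≡⟨ solve 3 (λ θ r m → (((con 1ℚ :- θ) :* r) :* (con 1ℚ :+ (θ :+ m)))
         := r :* ((con 1ℚ :+ m) :- θ :* (θ :+ m))) refl θ (ρ ^ℚ n) m ⟩
  ρ ^ℚ n ℚ.* ((1ℚ ℚ.+ m) ℚ.- θ ℚ.* (θ ℚ.+ m))
    ≤⟨ ℚ.*-monoˡ-≤-nonNeg (ρ ^ℚ n) {{ℚ.nonNegative (^-nonneg n 0≤ρ)}}
         (ℚ.+-monoʳ-≤ (1ℚ ℚ.+ m) (ℚ.neg-antimono-≤ (*-nonneg 0≤θ (ℚ.+-mono-≤ 0≤θ (•-nonneg n 0≤θ))))) ⟩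
  ρ ^ℚ n ℚ.* ((1ℚ ℚ.+ m) ℚ.+ 0ℚ)
    ≡⟨ cong (ρ ^ℚ n ℚ.*_) (ℚ.+-identityʳ (1ℚ ℚ.+ m)) ⟩
  ρ ^ℚ n ℚ.* (1ℚ ℚ.+ m)
    ≤⟨ bernoulli θ n 0≤θ 0≤ρ ⟩
  1ℚ ∎
  where
  open ℚ.≤-Reasoning
  open ℚ-Solver
  ρ = 1ℚ ℚ.- θ
  m = n • θ

-- Once nθδ ≥ 1, Bernoulli gives ρ^n ≤ ρ^n (1 + nθ) δ ≤ δ for ρ = 1 - θ.
ρ^n-small : ∀ {θ δ} → 0ℚ ℚ.< θ → 0ℚ ℚ.≤ 1ℚ ℚ.- θ → 0ℚ ℚ.< δ → ∃[ N ] (∀ n → N ℕ.≤ n → (1ℚ ℚ.- θ) ^ℚ n ℚ.≤ δ)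
ρ^n-small {θ} {δ} 0<θ 0≤ρ 0<δ =
  let 0<θδ = subst (ℚ._< θ ℚ.* δ) (ℚ.*-zeroʳ θ) (ℚ.*-monoʳ-<-pos θ {{ℚ.positive 0<θ}} 0<δ)
      d , h = archimedean 0<θδ
      0≤δ = ℚ.<⇒≤ 0<δ
  in suc d , λ n n≥ →
    let open ℚ.≤-Reasoning
        ρⁿ = (1ℚ ℚ.- θ) ^ℚ n
        1≤ : 1ℚ ℚ.≤ (n • θ) ℚ.* δ
        1≤ = begin
          1ℚ                 ≤⟨ ÷-mono-≤ 1 1 n (suc d) (subst₂ ℕ._≤_ (sym (ℕ.*-identityˡ _)) (sym (ℕ.*-identityʳ n)) n≥) ⟩
          n ÷ suc d          ≡⟨ sym (•-÷ n (suc d)) ⟩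
          n • (1 ÷ suc d)    ≤⟨ •-monoʳ-≤ n h ⟩
          n • (θ ℚ.* δ)      ≡⟨ •-*ʳ n θ δ ⟩
          (n • θ) ℚ.* δ      ∎
        n≤ : n • θ ℚ.≤ 1ℚ ℚ.+ n • θ
        n≤ = subst (ℚ._≤ 1ℚ ℚ.+ n • θ) (ℚ.+-identityˡ (n • θ)) (ℚ.+-monoˡ-≤ (n • θ) (ℚ.nonNegative⁻¹ 1ℚ))
    in begin
      ρⁿ                                   ≡⟨ sym (ℚ.*-identityʳ ρⁿ) ⟩
      ρⁿ ℚ.* 1ℚ                            ≤⟨ ℚ.*-monoˡ-≤-nonNeg ρⁿ {{ℚ.nonNegative (^-nonneg n 0≤ρ)}}
                                                (ℚ.≤-trans 1≤ (ℚ.*-monoʳ-≤-nonNeg δ {{ℚ.nonNegative 0≤δ}} n≤)) ⟩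
      ρⁿ ℚ.* ((1ℚ ℚ.+ n • θ) ℚ.* δ)        ≡⟨ sym (ℚ.*-assoc ρⁿ (1ℚ ℚ.+ n • θ) δ) ⟩
      (ρⁿ ℚ.* (1ℚ ℚ.+ n • θ)) ℚ.* δ        ≤⟨ ℚ.*-monoʳ-≤-nonNeg δ {{ℚ.nonNegative 0≤δ}} (bernoulli θ n (ℚ.<⇒≤ 0<θ) 0≤ρ) ⟩
      1ℚ ℚ.* δ                             ≡⟨ ℚ.*-identityˡ δ ⟩
      δ                                    ∎

-- A nonnegative real may have slightly negative approximants d, hence the bound on |d|. Of the gap
-- η below 1, half becomes θ; the other half absorbs the sign error, since 0 < 2d + θ gives -d < d +
-- θ < 1 - θ.
bounded-below-1 : ∀ {D} → 0ℝ ≤ᴿ D → D Real.< 1ℝ →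
  ∃[ θ ] (0ℚ ℚ.< θ × ∃[ N ] (∀ n → N ℕ.≤ n → ℚ.∣ seq D n ∣ ℚ.≤ 1ℚ ℚ.- θ))
bounded-below-1 {D} 0≤D (η , 0<η , N₁ , h₁) =
  let θ = ½ ℚ.* η
      0<θ = ½-pos 0<η
      N , h = eventually₂ (N₁ , h₁) (unwrap 0≤D (½ ℚ.* θ) (½-pos 0<θ))
      open ℚ.≤-Reasoning
      open ℚ-Solver
  in θ , 0<θ , N , λ n n≥ →
    let d = seq D n
        d+η<1 , 0<d+ = h n n≥
        up : d ℚ.< 1ℚ ℚ.- θ
        up = begin-strict
          d                      <⟨ p<p+q d 0<θ ⟩
          d ℚ.+ θ                ≡⟨ solve 2 (λ d t → d :+ t := (d :+ (t :+ t)) :- t) refl d θ ⟩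
          d ℚ.+ (θ ℚ.+ θ) ℚ.- θ  ≡⟨ cong (λ t → d ℚ.+ t ℚ.- θ) (½+½ η) ⟩
          d ℚ.+ η ℚ.- θ          <⟨ ℚ.+-monoˡ-< (ℚ.- θ) d+η<1 ⟩
          1ℚ ℚ.- θ               ∎
        lo : ℚ.- d ℚ.< 1ℚ ℚ.- θ
        lo = begin-strict
          ℚ.- d                  ≡⟨ solve 1 (λ d → :- d := (con 0ℚ :+ con 0ℚ) :- d) refl d ⟩
          0ℚ ℚ.+ 0ℚ ℚ.- d        <⟨ ℚ.+-monoˡ-< (ℚ.- d) (ℚ.+-mono-< 0<d+ 0<d+) ⟩
          (d ℚ.+ ½ ℚ.* θ) ℚ.+ (d ℚ.+ ½ ℚ.* θ) ℚ.- d
            ≡⟨ solve 2 (λ d u → ((d :+ u) :+ (d :+ u)) :- d := d :+ (u :+ u)) refl d (½ ℚ.* θ) ⟩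
          d ℚ.+ (½ ℚ.* θ ℚ.+ ½ ℚ.* θ) ≡⟨ cong (d ℚ.+_) (½+½ θ) ⟩
          d ℚ.+ θ                ≡⟨ solve 2 (λ d t → d :+ t := (d :+ (t :+ t)) :- t) refl d θ ⟩
          d ℚ.+ (θ ℚ.+ θ) ℚ.- θ  ≡⟨ cong (λ t → d ℚ.+ t ℚ.- θ) (½+½ η) ⟩
          d ℚ.+ η ℚ.- θ          <⟨ ℚ.+-monoˡ-< (ℚ.- θ) d+η<1 ⟩
          1ℚ ℚ.- θ               ∎
    in ∣p∣≤q (ℚ.<⇒≤ up) (ℚ.<⇒≤ lo)

-- The approximants of D^n are the n-th powers of those of D, so a bound 1 - θ on a tail of the
-- latter bounds the former by (1 - θ)^n.
geometric-small : ∀ C {D} → 0ℝ ≤ᴿ D → D Real.< 1ℝ → ∀ {ε} → 0ℚ ℚ.< ε →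
  ∃[ N ] (∀ n → N ℕ.≤ n → C Real.* D Real.^ n ≤ᴿ fromℚ ε)
geometric-small C {D} 0≤D D<1 {ε} 0<ε =
  let θ , 0<θ , M , hD = bounded-below-1 {D} 0≤D D<1
      B , B>0 , L , hC = bounded C
      δ , 0<δ , Bδ = divide B {{B>0}} 0<ε
      K , h = eventually₂ (M , hD) (L , hC)
      0≤ρ = ℚ.≤-trans (ℚ.nonNegative⁻¹ _ {{ℚ.∣-∣-nonNeg (seq D M)}}) (hD M ℕ.≤-refl)
      N , hρ = ρ^n-small 0<θ 0≤ρ 0<δ
  in N , λ n n≥ → wrap λ η 0<η → K , λ m m≥ →
    let open ℚ.≤-Reasoning
        D≤ , C≤ = h m m≥
    in begin-strict
      seq C m ℚ.* seq (D Real.^ n) m          ≤⟨ p≤∣p∣ _ ⟩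
      ℚ.∣ seq C m ℚ.* seq (D Real.^ n) m ∣    ≤⟨ ∣∣*-mono-≤ {seq C m} {seq (D Real.^ n) m} C≤ (∣D^n∣≤ρ^n D m n D≤) ⟩
      B ℚ.* (1ℚ ℚ.- θ) ^ℚ n                    ≤⟨ ℚ.*-monoˡ-≤-nonNeg B {{ℚ.pos⇒nonNeg B {{B>0}}}} (hρ n n≥) ⟩
      B ℚ.* δ                                 ≡⟨ Bδ ⟩
      ε                                       <⟨ p<p+q ε 0<η ⟩
      ε ℚ.+ η                                 ∎

-- Series

-- Linear arithmetic over the reals: a - b = x - y is checked termwise by the rational ring solver,
-- and the inequality is then transported.
linear₁ : ∀ {a b x y} → x ≤ᴿ y → (∀ n → seq a n ℚ.+ seq y n ≡ seq b n ℚ.+ seq x n) → a ≤ᴿ b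
linear₁ {a} {b} {x} {y} (wrap h) e = wrap λ ε 0<ε → let N , g = h ε 0<ε in N , λ n n≥ →
  +-cancelʳ-< (seq y n) (subst₂ ℚ._<_ (sym (e n))
    (solve 3 (λ b y e → b :+ (y :+ e) := (b :+ e) :+ y) refl (seq b n) (seq y n) ε)
    (ℚ.+-monoʳ-< (seq b n) (g n n≥)))
  where open ℚ-Solver

linear₂ : ∀ {a b x y z w} → x ≤ᴿ y → z ≤ᴿ w →
  (∀ n → seq a n ℚ.+ (seq y n ℚ.+ seq w n) ≡ seq b n ℚ.+ (seq x n ℚ.+ seq z n)) → a ≤ᴿ b
linear₂ {x = x} {y} {z} {w} h k e = linear₁ {x = x Real.+ z} {y Real.+ w} (+-mono-≤ {x} {y} {z} {w} h k) e

-- Two consecutive partial sums differ by c and both lie within δ/2 of l, so c ≤ δ for every δ.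
⟶-term : ∀ {c l} → partialSum (λ _ → c) ⟶ l → c ≤ᴿ 0ℝ
⟶-term {c} {l} h = ≤-fromℚ-closed λ δ 0<δ →
  let N , g = ⟶⇒≤ {partialSum (λ _ → c)} {l} h (½ ℚ.* δ) (½-pos 0<δ)
      P = partialSum (λ _ → c)
  in linear₂ {x = P (suc N)} {z = l} (proj₁ (g (suc N) (ℕ.n≤1+n N))) (proj₂ (g N ℕ.≤-refl))
    λ n → trans (solve 4 (λ c l p d → c :+ ((l :+ d) :+ (p :+ d)) := (d :+ d) :+ ((p :+ c) :+ l)) refl
                  (seq c n) (seq l n) (seq (P N) n) (½ ℚ.* δ))
                (cong (ℚ._+ ((seq (P N) n ℚ.+ seq c n) ℚ.+ seq l n)) (trans (½+½ δ) (sym (ℚ.+-identityˡ δ))))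
  where open ℚ-Solver

-- Finite additivity will come from countable additivity by padding two sets with empty ones; the
-- terms from index 2 on are then measures of ∅.
partialSum-two-≤ : ∀ g → (∀ n → g (2 ℕ.+ n) ≤ᴿ 0ℝ) → ∀ n → partialSum g (2 ℕ.+ n) ≤ᴿ g 0 Real.+ g 1
partialSum-two-≤ g h zero    = ≗⇒≤ λ n → cong (ℚ._+ seq (g 1) n) (ℚ.+-identityˡ (seq (g 0) n))
partialSum-two-≤ g h (suc m) = linear₂ {x = P} {z = g (2 ℕ.+ m)} (partialSum-two-≤ g h m) (h m) λ n →
  solve 4 (λ a b p c → (p :+ c) :+ ((a :+ b) :+ con 0ℚ) := (a :+ b) :+ (p :+ c)) refl
    (seq (g 0) n) (seq (g 1) n) (seq P n) (seq (g (2 ℕ.+ m)) n)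
  where
  open ℚ-Solver
  P = partialSum g (2 ℕ.+ m)

partialSum-two-≥ : ∀ g → (∀ n → 0ℝ ≤ᴿ g (2 ℕ.+ n)) → ∀ n → g 0 Real.+ g 1 ≤ᴿ partialSum g (2 ℕ.+ n)
partialSum-two-≥ g h zero    = ≗⇒≤ λ n → cong (ℚ._+ seq (g 1) n) (sym (ℚ.+-identityˡ (seq (g 0) n)))
partialSum-two-≥ g h (suc m) = linear₂ {y = P} {w = g (2 ℕ.+ m)} (partialSum-two-≥ g h m) (h m) λ n →
  solve 4 (λ a b p c → (a :+ b) :+ (p :+ c) := (p :+ c) :+ ((a :+ b) :+ con 0ℚ)) refl
    (seq (g 0) n) (seq (g 1) n) (seq P n) (seq (g (2 ℕ.+ m)) n)
  where
  open ℚ-Solver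
  P = partialSum g (2 ℕ.+ m)

⟶-two-≤ : ∀ g {l a b} → g 0 ≤ᴿ a → g 1 ≤ᴿ b → (∀ n → g (2 ℕ.+ n) ≤ᴿ 0ℝ) → partialSum g ⟶ l → l ≤ᴿ a Real.+ b
⟶-two-≤ g {l} {a} {b} ha hb h lim = ≤-trans {y = g 0 Real.+ g 1} (≤-fromℚ-closed λ δ 0<δ →
  let N , k = ⟶⇒≤ {partialSum g} {l} lim δ 0<δ
  in ≤-trans {y = partialSum g (2 ℕ.+ N) Real.+ fromℚ δ} (proj₂ (k (2 ℕ.+ N) (ℕ.m≤n+m N 2)))
       (+-monoˡ-≤ {partialSum g (2 ℕ.+ N)} {g 0 Real.+ g 1} (fromℚ δ) (partialSum-two-≤ g h N)))
  (+-mono-≤ {g 0} {a} {g 1} {b} ha hb)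

⟶-two-≥ : ∀ g {l a b} → a ≤ᴿ g 0 → b ≤ᴿ g 1 → (∀ n → 0ℝ ≤ᴿ g (2 ℕ.+ n)) → partialSum g ⟶ l → a Real.+ b ≤ᴿ l
⟶-two-≥ g {l} {a} {b} ha hb h lim = ≤-trans {y = g 0 Real.+ g 1} (+-mono-≤ {a} {g 0} {b} {g 1} ha hb)
  (≤-fromℚ-closed λ δ 0<δ →
    let N , k = ⟶⇒≤ {partialSum g} {l} lim δ 0<δ
    in ≤-trans {y = partialSum g (2 ℕ.+ N)} (partialSum-two-≥ g h N) (proj₁ (k (2 ℕ.+ N) (ℕ.m≤n+m N 2))))

-- Congruences

≡⇒mod : ∀ {m a b} → a ≡ b → a ≡ b [mod m ]
≡⇒mod {m} {a} refl = divides (+ 0) (solve 2 (λ a m → a :- a := con (+ 0) :* m) refl a (+ m))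
  where open ℤ-Solver

mod-sym : ∀ {m} a b → a ≡ b [mod m ] → b ≡ a [mod m ]
mod-sym {m} a b h = subst (+ m ∣_) (solve 2 (λ a b → :- (a :- b) := b :- a) refl a b) (∣m⇒∣-m h)
  where open ℤ-Solver

mod-trans : ∀ {m} a b c → a ≡ b [mod m ] → b ≡ c [mod m ] → a ≡ c [mod m ]
mod-trans {m} a b c h k = subst (+ m ∣_)
  (solve 3 (λ a b c → (a :- b) :+ (b :- c) := a :- c) refl a b c) (∣m∣n⇒∣m+n h k)
  where open ℤ-Solver

mod-+ : ∀ {m} a b c d → a ≡ b [mod m ] → c ≡ d [mod m ] → (a ℤ.+ c) ≡ (b ℤ.+ d) [mod m ]
mod-+ {m} a b c d h k = subst (+ m ∣_)
  (solve 4 (λ a b c d → (a :- b) :+ (c :- d) := (a :+ c) :- (b :+ d)) refl a b c d) (∣m∣n⇒∣m+n h k)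
  where open ℤ-Solver

mod-* : ∀ {m} a b c d → a ≡ b [mod m ] → c ≡ d [mod m ] → (a ℤ.* c) ≡ (b ℤ.* d) [mod m ]
mod-* {m} a b c d h k = subst (+ m ∣_)
  (solve 4 (λ a b c d → a :* (c :- d) :+ (a :- b) :* d := a :* c :- b :* d) refl a b c d)
  (∣m∣n⇒∣m+n (∣n⇒∣m*n a k) (∣m⇒∣m*n d h))
  where open ℤ-Solver

mod-%ℕ : ∀ a m .{{_ : ℕ.NonZero m}} → a ≡ + (a ℤ.%ℕ m) [mod m ]
mod-%ℕ a m = divides (a ℤ./ℕ m) (trans (cong (ℤ._- + (a ℤ.%ℕ m)) (ℤ.a≡a%ℕn+[a/ℕn]*n a m))
  (solve 2 (λ r t → (r :+ t) :- r := t) refl (+ (a ℤ.%ℕ m)) (a ℤ./ℕ m ℤ.* + m)))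
  where open ℤ-Solver

residue : ∀ m .{{_ : ℕ.NonZero m}} → ℤ → Fin m
residue m a = Fin.fromℕ< (ℤ.n%ℕd<d a m)

mod-residue : ∀ m .{{_ : ℕ.NonZero m}} a → a ≡ + toℕ (residue m a) [mod m ]
mod-residue m a = subst (λ t → a ≡ + t [mod m ]) (sym (Fin.toℕ-fromℕ< (ℤ.n%ℕd<d a m))) (mod-%ℕ a m)

∣m⊖n∣≡∣m-n∣ : ∀ m n → ℤ.∣ m ℤ.⊖ n ∣ ≡ ℕ.∣ m - n ∣
∣m⊖n∣≡∣m-n∣ zero    zero    = refl
∣m⊖n∣≡∣m-n∣ zero    (suc n) = refl
∣m⊖n∣≡∣m-n∣ (suc m) zero    = refl
∣m⊖n∣≡∣m-n∣ (suc m) (suc n) = trans (cong ℤ.∣_∣ (ℤ.[1+m]⊖[1+n]≡m⊖n m n)) (∣m⊖n∣≡∣m-n∣ m n)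

mod-injective : ∀ {m} (a b : Fin m) → + toℕ a ≡ + toℕ b [mod m ] → a ≡ b
mod-injective {m} a b h = Fin.toℕ-injective (ℕ.∣m-n∣≡0⇒m≡n (small ℕ.∣ toℕ a - toℕ b ∣ refl))
  where
  m∣ : m ℕ.∣ ℕ.∣ toℕ a - toℕ b ∣
  m∣ = subst (m ℕ.∣_) (trans (cong ℤ.∣_∣ (ℤ.m-n≡m⊖n (toℕ a) (toℕ b))) (∣m⊖n∣≡∣m-n∣ (toℕ a) (toℕ b))) (∣⇒∣ᵤ h)
  <m : ℕ.∣ toℕ a - toℕ b ∣ ℕ.< m
  <m = ℕ.≤-<-trans (ℕ.∣m-n∣≤m⊔n (toℕ a) (toℕ b)) (ℕ.⊔-lub (Fin.toℕ<n a) (Fin.toℕ<n b))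
  small : ∀ d → ℕ.∣ toℕ a - toℕ b ∣ ≡ d → ℕ.∣ toℕ a - toℕ b ∣ ≡ 0
  small zero    e = e
  small (suc d) e = contradiction (ℕ.∣⇒≤ (subst (m ℕ.∣_) e m∣)) (ℕ.<⇒≱ (subst (ℕ._< m) e <m))

-- Infinite sets of natural numbers

-- Subsequences are represented by infinite sets of indices, so passing to a subsequence means
-- strengthening the predicate.
Infinite : Pred ℕ 0ℓ → Set
Infinite P = ∀ N → ∃[ n ] (N ℕ.≤ n × P n)

finite-bound : ∀ k (f : Fin k → ℕ) → ∃[ B ] (∀ j → f j ℕ.≤ B)
finite-bound zero    f = 0 , λ ()
finite-bound (suc k) f = let B , h = finite-bound k (λ j → f (Fin.suc j)) in
  f Fin.zero ℕ.⊔ B , λ { Fin.zero → ℕ.m≤m⊔n _ B ; (Fin.suc j) → ℕ.≤-trans (h j) (ℕ.m≤n⊔m (f Fin.zero) B) }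

module Classical (em : ExcludedMiddle 0ℓ) where

  by-contradiction : ∀ {P : Set} → ¬ ¬ P → P
  by-contradiction = decidable-stable em

  ¬∀⇒∃¬ : ∀ {A : Set} {P : A → Set} → ¬ (∀ x → P x) → ∃[ x ] ¬ P x
  ¬∀⇒∃¬ h = by-contradiction λ k → h λ x → by-contradiction λ ¬Px → k (x , ¬Px)

  ¬Infinite⇒bounded : ∀ {P} → ¬ Infinite P → ∃[ N ] (∀ n → N ℕ.≤ n → ¬ P n)
  ¬Infinite⇒bounded h = let N , k = ¬∀⇒∃¬ h in N , λ n n≥ Pn → k (n , n≥ , Pn)

  pigeonhole : ∀ {k P} (c : ℕ → Fin k) → Infinite P → ∃[ j ] Infinite (λ n → P n × c n ≡ j)
  pigeonhole {k} {P} c inf = by-contradiction λ h →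
    let bound : ∀ j → ∃[ N ] (∀ n → N ℕ.≤ n → ¬ (P n × c n ≡ j))
        bound j = ¬Infinite⇒bounded λ i → h (j , i)
        B , B≥ = finite-bound k (λ j → proj₁ (bound j))
        n , n≥ , Pn = inf B
    in proj₂ (bound (c n)) n (ℕ.≤-trans (B≥ (c n)) n≥) (Pn , refl)

  -- The search descends from n to the first success. It is applied to decreasing predicates, for
  -- which such a j is unique.
  least-failure : ∀ {P : ℕ → Set} → P 0 → ∀ n → ¬ P n → ∃[ j ] (P j × ¬ P (suc j))
  least-failure         P0 zero    ¬P = contradiction P0 ¬P
  least-failure {P = P} P0 (suc n) ¬P with em {P n}
  ... | yes Pn = n , Pn , ¬P
  ... | no ¬Pn = least-failure P0 n ¬Pn

-- p-adic integers

module PadicProperties (em : ExcludedMiddle 0ℓ) (p : ℕ) (p-prime : Prime p) where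
  open Padic p p-prime
  open Classical em

  instance
    p-nonZero : ℕ.NonZero p
    p-nonZero = prime⇒nonZero p-prime

  p^-nonZero : ∀ n → ℕ.NonZero (p ℕ.^ n)
  p^-nonZero n = ℕ.m^n≢0 p n

  p^∣p^ : ∀ {m n} → m ℕ.≤ n → + (p ℕ.^ m) ∣ + (p ℕ.^ n)
  p^∣p^ {m} {n} m≤n = divides (+ (p ℕ.^ (n ℕ.∸ m)))
    (trans (cong (λ t → + (p ℕ.^ t)) (sym (ℕ.m∸n+n≡m m≤n)))
      (trans (cong +_ (ℕ.^-distribˡ-+-* p (n ℕ.∸ m) m)) (ℤ.pos-* (p ℕ.^ (n ℕ.∸ m)) (p ℕ.^ m))))

  mod-weaken : ∀ {m n} → m ℕ.≤ n → ∀ a b → a ≡ b [mod p ℕ.^ n ] → a ≡ b [mod p ℕ.^ m ]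
  mod-weaken m≤n a b = ∣-trans (p^∣p^ m≤n)

  mod-1 : ∀ a b → a ≡ b [mod p ℕ.^ 0 ]
  mod-1 a b = divides (a ℤ.- b) (sym (ℤ.*-identityʳ (a ℤ.- b)))

  coherent-+ : ∀ x m d → res x (d ℕ.+ m) ≡ res x m [mod p ℕ.^ m ]
  coherent-+ x m zero    = ≡⇒mod {b = res x m} refl
  coherent-+ x m (suc d) = mod-trans (res x (suc d ℕ.+ m)) (res x (d ℕ.+ m)) (res x m)
    (mod-weaken (ℕ.m≤n+m m d) (res x (suc d ℕ.+ m)) (res x (d ℕ.+ m)) (coherent x (d ℕ.+ m)))
    (coherent-+ x m d)

  coherent-≤ : ∀ x {m n} → m ℕ.≤ n → res x n ≡ res x m [mod p ℕ.^ m ]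
  coherent-≤ x {m} {n} m≤n = subst (λ t → res x t ≡ res x m [mod p ℕ.^ m ]) (ℕ.m∸n+n≡m m≤n) (coherent-+ x m (n ℕ.∸ m))

  Ball-refl : ∀ x α → Ball x α x
  Ball-refl x α = ≡⇒mod {b = res x α} refl

  Ball-sym : ∀ {x y α} → Ball x α y → Ball y α x
  Ball-sym {x} {y} {α} = mod-sym (res y α) (res x α)

  Ball-trans : ∀ {x y z α} → Ball x α y → Ball y α z → Ball x α z
  Ball-trans {x} {y} {z} {α} h k = mod-trans (res z α) (res y α) (res x α) k h

  Ball-weaken : ∀ {x y α β} → α ℕ.≤ β → Ball x β y → Ball x α y
  Ball-weaken {x} {y} {α} {β} α≤β h = mod-trans (res y α) (res y β) (res x α)
    (mod-sym (res y β) (res y α) (coherent-≤ y α≤β))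
    (mod-trans (res y β) (res x β) (res x α) (mod-weaken α≤β (res y β) (res x β) h) (coherent-≤ x α≤β))

  -- The set X_α of the overview.
  Nbhd : Pred ℤₚ 0ℓ → ℕ → Pred ℤₚ 0ℓ
  Nbhd E α x = ∃[ y ] (y ∈ E × Ball y α x)

  -- Compactness of ℤₚ, digit by digit: a class modulo p^m hit infinitely often contains, by the
  -- pigeonhole principle, a class modulo p^(m+1) hit infinitely often. The chosen classes are the
  -- residues of z.
  cluster-point : ∀ {P} (y : ℕ → ℤₚ) → Infinite P → ∃[ z ] (∀ m → Infinite (λ n → P n × Ball z m (y n)))
  cluster-point {P} y inf = mkℤₚ (λ m → proj₁ (stage m)) (λ m → refine-coherent m (stage m)) , λ m → proj₂ (stage m)
    where
    Stage : ℕ → Set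
    Stage m = Σ[ a ∈ ℤ ] Infinite (λ n → P n × (res (y n) m ≡ a [mod p ℕ.^ m ]))

    module _ (m : ℕ) (st : Stage m) where
      c : ℕ → Fin (p ℕ.^ suc m)
      c n = residue (p ℕ.^ suc m) {{p^-nonZero (suc m)}} (res (y n) (suc m))

      chosen : ∃[ j ] Infinite (λ n → (P n × (res (y n) m ≡ proj₁ st [mod p ℕ.^ m ])) × c n ≡ j)
      chosen = pigeonhole c (proj₂ st)

      next : ℤ
      next = + toℕ (proj₁ chosen)

      hits : ∀ n → c n ≡ proj₁ chosen → res (y n) (suc m) ≡ next [mod p ℕ.^ suc m ]
      hits n e = subst (λ j → res (y n) (suc m) ≡ + toℕ j [mod p ℕ.^ suc m ]) e
        (mod-residue (p ℕ.^ suc m) {{p^-nonZero (suc m)}} (res (y n) (suc m)))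

      refine : Stage (suc m)
      refine = next , λ N → let n , n≥ , (Pn , _) , e = proj₂ chosen N in n , n≥ , Pn , hits n e

      refine-coherent : next ≡ proj₁ st [mod p ℕ.^ m ]
      refine-coherent =
        -- A single index hitting both classes is enough to make them compatible.
        let n , _ , (_ , h) , e = proj₂ chosen 0
            yₙ = y n
        in mod-trans next (res yₙ (suc m)) (proj₁ st)
             (mod-sym (res yₙ (suc m)) next (mod-weaken (ℕ.n≤1+n m) (res yₙ (suc m)) next (hits n e)))
             (mod-trans (res yₙ (suc m)) (res yₙ m) (proj₁ st) (coherent yₙ m) h)

    stage : ∀ m → Stage m
    stage zero    = + 0 , λ N → let n , n≥ , Pn = inf N in n , n≥ , Pn , mod-1 (res (y n) 0) (+ 0)
    stage (suc m) = refine m (stage m)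

  Divisible : ℤₚ → ℕ → Set
  Divisible z k = res z k ≡ + 0 [mod p ℕ.^ k ]

  valuation : ∀ z → (∀ n → Divisible z n) ⊎ (∃[ j ] (Divisible z j × ¬ Divisible z (suc j)))
  valuation z with em {∀ n → Divisible z n}
  ... | yes h = inj₁ h
  ... | no ¬h = let n , ¬D = ¬∀⇒∃¬ ¬h in inj₂ (least-failure {P = Divisible z} (mod-1 (res z 0) (+ 0)) n ¬D)

  -- Division by p^j costs j digits, so residue n of the unit is read off from residue n + j of z.
  -- The unit is what `abs-nonzero` asks for.
  unit-part : ∀ z j → Divisible z j → ¬ Divisible z (suc j) →
    Σ[ u ∈ ℤₚ ] (¬ Divisible u 1 × z ≈ₚ p^ j *ₚ u)
  unit-part z j d ¬d = mkℤₚ u u-coherent , ¬unit , λ n →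
      mod-trans (res z n) (res z (n ℕ.+ j)) (+ (p ℕ.^ j) ℤ.* u n)
        (mod-sym (res z (n ℕ.+ j)) (res z n) (coherent-≤ z (ℕ.m≤m+n n j)))
        (≡⇒mod (trans (u-eq n) (ℤ.*-comm (u n) (+ (p ℕ.^ j)))))
    where
    p^j∣ : ∀ n → + (p ℕ.^ j) ∣ res z (n ℕ.+ j)
    p^j∣ n = subst (+ (p ℕ.^ j) ∣_) (ℤ.+-identityʳ (res z (n ℕ.+ j)))
      (mod-trans (res z (n ℕ.+ j)) (res z j) (+ 0) (coherent-+ z j n) d)

    u : ℕ → ℤ
    u n = _∣_.quotient (p^j∣ n)

    u-eq : ∀ n → res z (n ℕ.+ j) ≡ u n ℤ.* + (p ℕ.^ j)
    u-eq n = _∣_.equality (p^j∣ n)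

    p^-+ : ∀ n → + (p ℕ.^ (n ℕ.+ j)) ≡ + (p ℕ.^ n) ℤ.* + (p ℕ.^ j)
    p^-+ n = trans (cong +_ (ℕ.^-distribˡ-+-* p n j)) (ℤ.pos-* (p ℕ.^ n) (p ℕ.^ j))

    u-coherent : ∀ n → u (suc n) ≡ u n [mod p ℕ.^ n ]
    u-coherent n = *-cancelʳ-∣ (+ (p ℕ.^ j)) {{p^-nonZero j}} (subst₂ _∣_ (p^-+ n)
      (trans (cong₂ ℤ._-_ (u-eq (suc n)) (u-eq n))
        (solve 3 (λ a b c → a :* c :- b :* c := (a :- b) :* c) refl (u (suc n)) (u n) (+ (p ℕ.^ j))))
      (coherent z (n ℕ.+ j)))
      where open ℤ-Solver

    ¬unit : ¬ (u 1 ≡ + 0 [mod p ℕ.^ 1 ])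
    ¬unit h = ¬d (subst₂ _∣_ (sym (p^-+ 1))
      (trans (cong (ℤ._* + (p ℕ.^ j)) (ℤ.+-identityʳ (u 1))) (trans (sym (u-eq 1)) (sym (ℤ.+-identityʳ (res z (suc j))))))
      (*-monoˡ-∣ (+ (p ℕ.^ j)) h))

-- The radii 1/p^k

module RatioProperties (em : ExcludedMiddle 0ℓ) (p : ℕ) (p-prime : Prime p) where
  open Padic p p-prime
  open PadicProperties em p p-prime

  p≥2 : 2 ℕ.≤ p
  p≥2 = ℕ.nonTrivial⇒n>1 p {{prime⇒nonTrivial p-prime}}

  n<p^n : ∀ n → n ℕ.< p ℕ.^ n
  n<p^n zero    = ℕ.≤-refl
  n<p^n (suc n) = begin-strict
    suc n                    ≤⟨ n<p^n n ⟩
    p ℕ.^ n                  <⟨ ℕ.m<m+n (p ℕ.^ n) {p ℕ.^ n} (ℕ.m^n>0 p n) ⟩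
    p ℕ.^ n ℕ.+ p ℕ.^ n      ≡⟨ cong (p ℕ.^ n ℕ.+_) (sym (ℕ.+-identityʳ (p ℕ.^ n))) ⟩
    2 ℕ.* p ℕ.^ n            ≤⟨ ℕ.*-monoˡ-≤ (p ℕ.^ n) p≥2 ⟩
    p ℕ.* p ℕ.^ n            ∎
    where open ℕ.≤-Reasoning

  _÷p^_ : ℕ → ℕ → ℚ
  c ÷p^ k = _÷_ c (p ℕ.^ k) {{p^-nonZero k}}

  ÷p^-pos : ∀ k → 0ℚ ℚ.< 1 ÷p^ k
  ÷p^-pos k = ÷-mono-< 0 1 1 (p ℕ.^ k) {{_}} {{p^-nonZero k}} (ℕ.s≤s ℕ.z≤n)

  ÷p^-antimono : ∀ {j k} → j ℕ.≤ k → 1 ÷p^ k ℚ.≤ 1 ÷p^ j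
  ÷p^-antimono {j} {k} j≤k = ÷-mono-≤ 1 (p ℕ.^ k) 1 (p ℕ.^ j) {{p^-nonZero k}} {{p^-nonZero j}}
    (ℕ.*-monoʳ-≤ 1 (ℕ.^-monoʳ-≤ p j≤k))

  ÷p^-strict : ∀ j → 1 ÷p^ suc j ℚ.< 1 ÷p^ j
  ÷p^-strict j = ÷-mono-< 1 (p ℕ.^ suc j) 1 (p ℕ.^ j) {{p^-nonZero (suc j)}} {{p^-nonZero j}}
    (ℕ.*-monoʳ-< 1 (ℕ.^-monoʳ-< p p≥2 {j} {suc j} ℕ.≤-refl))

  -- Because p ≥ 2, raising the index by one pays for one use of the triangle inequality.
  ÷p^-halve : ∀ k → 1 ÷p^ suc k ℚ.+ 1 ÷p^ suc k ℚ.≤ 1 ÷p^ k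
  ÷p^-halve k = subst (ℚ._≤ 1 ÷p^ k) (sym (÷-+ 1 1 (p ℕ.^ suc k) {{p^-nonZero (suc k)}}))
    (÷-mono-≤ 2 (p ℕ.^ suc k) 1 (p ℕ.^ k) {{p^-nonZero (suc k)}} {{p^-nonZero k}}
      (ℕ.≤-trans (ℕ.*-monoˡ-≤ (p ℕ.^ k) p≥2) (ℕ.≤-reflexive (sym (ℕ.*-identityˡ (p ℕ.^ suc k))))))

  ÷p^-small : ∀ c {δ} → 0ℚ ℚ.< δ → ∃[ N ] (∀ n → N ℕ.≤ n → c ÷p^ n ℚ.≤ δ)
  ÷p^-small c {δ} 0<δ = let d , h = archimedean 0<δ in c ℕ.* suc d , λ n n≥ →
    ℚ.≤-trans (÷-mono-≤ c (p ℕ.^ n) 1 (suc d) {{p^-nonZero n}}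
      (ℕ.≤-trans n≥ (ℕ.≤-trans (ℕ.<⇒≤ (n<p^n n)) (ℕ.≤-reflexive (sym (ℕ.*-identityˡ (p ℕ.^ n))))))) h

-- Approximation in K

module Nearness (em : ExcludedMiddle 0ℓ) (p : ℕ) (p-prime : Prime p)
  (K : Padic.FiniteExtension p p-prime) (absK : Padic.AbsoluteValue p p-prime K) where

  open Padic p p-prime
  open PadicProperties em p p-prime
  open RatioProperties em p p-prime
  open FiniteExtension K using (Carrier; ring; ι; embed-hom)
    renaming (_≈_ to _≈ᴷ_; _+_ to _+ᴷ_; _-_ to _-ᴷ_; -_ to -ᴷ_; _*_ to _*ᴷ_; 0# to 0ᴷ; 1# to 1ᴷ)
  private module K = FiniteExtension K
  open AbsoluteValue absK
  open IsRingHomomorphism embed-hom using (⟦⟧-cong; +-homo; -‿homo; 1#-homo)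
  open RingProperties ring using (-1*x≈-x)
  open SetoidReasoning K.setoid

  -- Only the radii 1/p^k occur, so that nearness in K can be compared with `Ball` in ℤₚ.
  record Near (k : ℕ) (a b : Carrier) : Set where
    constructor near
    field bound : abs (a -ᴷ b) ≤ᴿ ratio 1 k

  abs-cong-≤ : ∀ {x y c} → x ≈ᴷ y → abs x ≤ᴿ c → abs y ≤ᴿ c
  abs-cong-≤ x≈y h = ≤-trans (≈⇒≥ (abs-cong x≈y)) h

  near-trans : ∀ {k a b c} → Near (suc k) a b → Near (suc k) b c → Near k a c
  near-trans {k} {a} {b} {c} (near h) (near g) = near (abs-cong-≤ eq
    (≤-trans {y = abs (a -ᴷ b) Real.+ abs (b -ᴷ c)} (wrap (abs-triangle (a -ᴷ b) (b -ᴷ c)))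
      (+-fromℚ-≤ {abs (a -ᴷ b)} {abs (b -ᴷ c)} h g (÷p^-halve k))))
    where
    eq : (a -ᴷ b) +ᴷ (b -ᴷ c) ≈ᴷ a -ᴷ c
    eq = begin
      (a -ᴷ b) +ᴷ (b -ᴷ c)          ≈⟨ K.+-assoc a (-ᴷ b) (b -ᴷ c) ⟩
      a +ᴷ (-ᴷ b +ᴷ (b -ᴷ c))       ≈⟨ K.+-congˡ (K.+-assoc (-ᴷ b) b (-ᴷ c)) ⟨
      a +ᴷ ((-ᴷ b +ᴷ b) -ᴷ c)       ≈⟨ K.+-congˡ (K.+-congʳ (K.-‿inverseˡ b)) ⟩
      a +ᴷ (0ᴷ -ᴷ c)                ≈⟨ K.+-congˡ (K.+-identityˡ (-ᴷ c)) ⟩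
      a -ᴷ c                        ∎

  near-weaken : ∀ {j k a b} → j ℕ.≤ k → Near k a b → Near j a b
  near-weaken {j} {k} {a} {b} j≤k (near h) = near (≤-trans h (fromℚ-mono-≤ (÷p^-antimono j≤k)))

  abs-≈0-≤ : ∀ {x} → x ≈ᴷ 0ᴷ → ∀ k → abs x ≤ᴿ ratio 1 k
  abs-≈0-≤ {x} x≈0 k = ≤-trans (≈⇒≤ (abs-0 x≈0)) (fromℚ-mono-≤ (ℚ.<⇒≤ (÷p^-pos k)))

  ≈⇒near : ∀ {a b} → a ≈ᴷ b → ∀ k → Near k a b
  ≈⇒near {a} {b} a≈b k = near (abs-≈0-≤ (K.trans (K.+-congʳ a≈b) (K.-‿inverseʳ b)) k)

  near⇒≈ : ∀ {a b} → (∀ k → Near k a b) → a ≈ᴷ b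
  near⇒≈ {a} {b} h = begin
    a                     ≈⟨ K.+-identityʳ a ⟨
    a +ᴷ 0ᴷ               ≈⟨ K.+-congˡ (K.-‿inverseˡ b) ⟨
    a +ᴷ (-ᴷ b +ᴷ b)      ≈⟨ K.+-assoc a (-ᴷ b) b ⟨
    (a -ᴷ b) +ᴷ b         ≈⟨ K.+-congʳ (abs-definite (≤-antisym small (wrap (abs-nonneg (a -ᴷ b))))) ⟩
    0ᴷ +ᴷ b               ≈⟨ K.+-identityˡ b ⟩
    b                     ∎
    where
    small : abs (a -ᴷ b) ≤ᴿ 0ℝ
    small = ≤-fromℚ-closed λ δ 0<δ →
      let k , hk = ÷p^-small 1 0<δ in
      ≤-trans {y = fromℚ δ} (≤-trans (Near.bound (h k)) (fromℚ-mono-≤ (hk k ℕ.≤-refl))) (≗⇒≤ (λ _ → sym (ℚ.+-identityˡ δ)))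

  abs-unit : ∀ z → ¬ Divisible z 1 → abs (ι z) Real.≈ 1ℝ
  abs-unit z ¬d = abs-extends (abs-nonzero z 0 0 ¬d λ n →
    ≡⇒mod (cong (ℤ._* + 1) (sym (ℤ.*-identityˡ (res z n)))))

  -- The two differences are related by the factor ι(-1), of absolute value 1 because p does not
  -- divide -1.
  near-sym : ∀ {k a b} → Near k a b → Near k b a
  near-sym {k} {a} {b} (near h) = near (abs-cong-≤ eq
    (≤-trans (≤-trans (≈⇒≤ (abs-* -1ᴷ (a -ᴷ b)))
        (≈1⇒*-≤ {abs -1ᴷ} (abs (a -ᴷ b)) (abs-unit -1ₚ ¬p∣-1)))
      h))
    where
    -1ₚ = -ₚ fromℕ 1
    -1ᴷ = ι -1ₚ
    ¬p∣-1 : ¬ Divisible -1ₚ 1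
    ¬p∣-1 d = ℕ.<⇒≱ (subst (1 ℕ.<_) (sym (ℕ.*-identityʳ p)) p≥2) (ℕ.∣⇒≤ (∣⇒∣ᵤ d))
    eq : -1ᴷ *ᴷ (a -ᴷ b) ≈ᴷ b -ᴷ a
    eq = begin
      -1ᴷ *ᴷ (a -ᴷ b)           ≈⟨ K.*-congʳ (K.trans (-‿homo (fromℕ 1 /p^ 0)) (K.-‿cong 1#-homo)) ⟩
      -ᴷ 1ᴷ *ᴷ (a -ᴷ b)         ≈⟨ -1*x≈-x (a -ᴷ b) ⟩
      -ᴷ (a -ᴷ b)               ≈⟨ ⁻¹-anti-homo-// a b ⟩
      b -ᴷ a                    ∎
      where open GroupProperties K.+-group using (⁻¹-anti-homo-//)

  abs-ι-val : ∀ z j → Divisible z j → ¬ Divisible z (suc j) → abs (ι z) Real.≈ ratio 1 j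
  abs-ι-val z j d ¬d = let u , ¬u , e = unit-part z j d ¬d in
    abs-extends (abs-nonzero u j 0 ¬u λ n →
      mod-* (res z n) (+ (p ℕ.^ j) ℤ.* res u n) (+ 1) (+ 1) (e n) (≡⇒mod {b = + 1} refl))

  Divisible-weaken : ∀ z {j k} → j ℕ.≤ k → Divisible z k → Divisible z j
  Divisible-weaken z j≤k = Ball-weaken {fromℕ 0} {z} j≤k

  -- Either z is zero or |ι z| = 1/p^j for the exact power p^j dividing z. With the converse below,
  -- this identifies the metric that K induces on ℤₚ with congruence.
  Divisible⇒abs-≤ : ∀ z k → Divisible z k → abs (ι z) ≤ᴿ ratio 1 k
  Divisible⇒abs-≤ z k d = cases (valuation z)
    where
    cases : (∀ n → Divisible z n) ⊎ (∃[ j ] (Divisible z j × ¬ Divisible z (suc j))) → abs (ι z) ≤ᴿ ratio 1 k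
    cases (inj₁ z≈0) = ≤-trans {y = 0ℝ}
      (≈⇒≤ (abs-extends (abs-zero λ n →
        mod-* (res z n) (+ 0) (+ 1) (+ 1) (z≈0 n) (≡⇒mod {b = + 1} refl))))
      (fromℚ-mono-≤ (ℚ.<⇒≤ (÷p^-pos k)))
    cases (inj₂ (j , dj , ¬dj)) = ≤-trans {y = ratio 1 j} (≈⇒≤ (abs-ι-val z j dj ¬dj))
      (fromℚ-mono-≤ (÷p^-antimono (ℕ.≮⇒≥ λ j<k → ¬dj (Divisible-weaken z j<k d))))

  abs-≤⇒Divisible : ∀ z k → abs (ι z) ≤ᴿ ratio 1 k → Divisible z k
  abs-≤⇒Divisible z k h = cases (valuation z)
    where
    cases : (∀ n → Divisible z n) ⊎ (∃[ j ] (Divisible z j × ¬ Divisible z (suc j))) → Divisible z k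
    cases (inj₁ z≈0) = z≈0 k
    cases (inj₂ (j , dj , ¬dj)) = Divisible-weaken z (ℕ.≮⇒≥ λ j<k →
      let 1÷p^j≤1÷p^k = fromℚ-cancel-≤ {1 ÷p^ j} {1 ÷p^ k} (≤-trans {y = abs (ι z)} (≈⇒≥ (abs-ι-val z j dj ¬dj)) h)
      in ℚ.<-irrefl refl (ℚ.≤-<-trans 1÷p^j≤1÷p^k (ℚ.≤-<-trans (÷p^-antimono j<k) (÷p^-strict j)))) dj

  private
    infixl 6 _⊖_
    -- The numerator that addition in ℚₚ produces for x/p^0 + (-y)/p^0, so that the homomorphism law
    -- of `embed` applies definitionally.
    _⊖_ : ℤₚ → ℤₚ → ℤₚ
    x ⊖ y = x *ₚ p^ 0 +ₚ (-ₚ y) *ₚ p^ 0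

    ι-⊖ : ∀ x y → ι (x ⊖ y) ≈ᴷ ι x -ᴷ ι y
    ι-⊖ x y = K.trans (+-homo (x /p^ 0) ((-ₚ y) /p^ 0)) (K.+-congˡ (-‿homo (y /p^ 0)))

    ⊖-res : ∀ x y k → res (x ⊖ y) k ℤ.- + 0 ≡ res x k ℤ.- res y k
    ⊖-res x y k = solve 2 (λ a b → (a :* con (+ 1) :+ (:- b) :* con (+ 1)) :- con (+ 0) := a :- b) refl (res x k) (res y k)
      where open ℤ-Solver

  Ball⇒near : ∀ {x y} k → Ball y k x → Near k (ι x) (ι y)
  Ball⇒near {x} {y} k b = near (abs-cong-≤ (ι-⊖ x y)
    (Divisible⇒abs-≤ (x ⊖ y) k (subst (+ (p ℕ.^ k) ∣_) (sym (⊖-res x y k)) b)))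

  near⇒Ball : ∀ {x y} k → Near k (ι x) (ι y) → Ball y k x
  near⇒Ball {x} {y} k (near h) = subst (+ (p ℕ.^ k) ∣_) (⊖-res x y k)
    (abs-≤⇒Divisible (x ⊖ y) k (abs-cong-≤ (K.sym (ι-⊖ x y)) h))

  ι-cong : ∀ {x y} → x ≈ₚ y → ι x ≈ᴷ ι y
  ι-cong {x} {y} e = near⇒≈ λ k → Ball⇒near {x} {y} k (e k)

  continuous⇒near : ∀ {g} → Continuous K absK g → ∀ x k → ∃[ m ] (∀ y → Ball x m y → Near k (g y) (g x))
  continuous⇒near {g} cont x k =
    let δ , 0<δ , h = cont x (ratio 1 k) (fromℚ-pos (÷p^-pos k))
        η , 0<η , dom = positive-dominates {δ} 0<δ
        m , hm = ÷p^-small 1 0<η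
    in m , λ y b → near (<⇒≤ (h y (dom {abs (ι y -ᴷ ι x)} (≤-trans (Near.bound (Ball⇒near {y} {x} m b)) (fromℚ-mono-≤ (hm m ℕ.≤-refl))))))

-- Simultaneous congruences modulo p^f - 1 and p^k

-- Powers of p^f are 1 modulo p^f - 1. The explicit quotient turns the congruence in `crt` into a
-- polynomial identity.
[1+m]^k≡1+m*c : ∀ m k → ∃[ c ] ((1 ℕ.+ m) ℕ.^ k ≡ 1 ℕ.+ m ℕ.* c)
[1+m]^k≡1+m*c m zero    = 0 , cong suc (sym (ℕ.*-zeroʳ m))
[1+m]^k≡1+m*c m (suc k) = let c , e = [1+m]^k≡1+m*c m k in
  1 ℕ.+ c ℕ.+ m ℕ.* c , trans (cong ((1 ℕ.+ m) ℕ.*_) e)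
    (solve 2 (λ m c → (con 1 :+ m) :* (con 1 :+ m :* c) := con 1 :+ m :* (con 1 :+ c :+ m :* c)) refl m c)
  where open ℕ-Solver

-- The witness is a + (p^f)^k t with t ≡ i - a modulo p^f - 1.
crt : ∀ p f m k i a N .{{_ : ℕ.NonZero p}} → 1 ℕ.≤ f → p ℕ.^ f ≡ 1 ℕ.+ suc m →
  ∃[ n ] (N ℕ.≤ n × (+ n ≡ + i [mod suc m ]) × (+ n ≡ + a [mod p ℕ.^ k ]))
crt p (suc f) m k i a N (ℕ.s≤s _) e = n , N≤n , mod-m , mod-p
  where
  open ℕ-Solver
  P t c n : ℕ
  P = (1 ℕ.+ suc m) ℕ.^ k
  -- The modulus is m + 1, so a m stands for -a without subtraction; the multiple of N makes n large
  -- without changing its class.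
  t = i ℕ.+ a ℕ.* m ℕ.+ suc m ℕ.* N
  c = proj₁ ([1+m]^k≡1+m*c (suc m) k)
  n = a ℕ.+ P ℕ.* t

  N≤n : N ℕ.≤ n
  N≤n = begin
    N            ≤⟨ ℕ.m≤m+n N (m ℕ.* N) ⟩
    suc m ℕ.* N  ≤⟨ ℕ.m≤n+m (suc m ℕ.* N) (i ℕ.+ a ℕ.* m) ⟩
    t            ≤⟨ ℕ.m≤n*m t P {{ℕ.m^n≢0 (1 ℕ.+ suc m) k}} ⟩
    P ℕ.* t      ≤⟨ ℕ.m≤n+m (P ℕ.* t) a ⟩
    n            ∎
    where open ℕ.≤-Reasoning

  n≡ : n ≡ (a ℕ.+ N ℕ.+ c ℕ.* t) ℕ.* suc m ℕ.+ i
  n≡ = trans (cong (λ P → a ℕ.+ P ℕ.* t) (proj₂ ([1+m]^k≡1+m*c (suc m) k)))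
    (solve 5 (λ a i m N c →
      let t = i :+ a :* m :+ (con 1 :+ m) :* N in
      a :+ (con 1 :+ (con 1 :+ m) :* c) :* t := (a :+ N :+ c :* t) :* (con 1 :+ m) :+ i) refl a i m N c)

  mod-m : + n ≡ + i [mod suc m ]
  mod-m = divides (+ (a ℕ.+ N ℕ.+ c ℕ.* t)) (trans (cong (λ n → + n ℤ.- + i) n≡)
    (trans (cong (ℤ._- + i) (ℤ.pos-+ ((a ℕ.+ N ℕ.+ c ℕ.* t) ℕ.* suc m) i))
      (trans (+i-i (+ ((a ℕ.+ N ℕ.+ c ℕ.* t) ℕ.* suc m)) (+ i)) (ℤ.pos-* (a ℕ.+ N ℕ.+ c ℕ.* t) (suc m)))))
    where
    +i-i : ∀ x i → x ℤ.+ i ℤ.- i ≡ x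
    +i-i = ℤ-Solver.solve 2 (λ x i → (x ℤ-Solver.:+ i) ℤ-Solver.:- i ℤ-Solver.:= x) refl

  -- Here the exponent is f + 1, so (f + 1)k = fk + k leaves the factor p^k.
  P≡ : P ≡ p ℕ.^ (f ℕ.* k) ℕ.* p ℕ.^ k
  P≡ = trans (cong (ℕ._^ k) (sym e)) (trans (ℕ.^-*-assoc p (suc f) k)
    (trans (cong (p ℕ.^_) (ℕ.+-comm k (f ℕ.* k))) (ℕ.^-distribˡ-+-* p (f ℕ.* k) k)))

  mod-p : + n ≡ + a [mod p ℕ.^ k ]
  mod-p = divides (+ (t ℕ.* p ℕ.^ (f ℕ.* k))) (trans (cong (ℤ._- + a) (ℤ.pos-+ a (P ℕ.* t)))
    (trans (a+-a (+ a) (+ (P ℕ.* t))) (trans (cong +_ Pt≡) (ℤ.pos-* (t ℕ.* p ℕ.^ (f ℕ.* k)) (p ℕ.^ k)))))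
    where
    a+-a : ∀ a x → a ℤ.+ x ℤ.- a ≡ x
    a+-a = ℤ-Solver.solve 2 (λ a x → (a ℤ-Solver.:+ x) ℤ-Solver.:- a ℤ-Solver.:= x) refl
    Pt≡ : P ℕ.* t ≡ t ℕ.* p ℕ.^ (f ℕ.* k) ℕ.* p ℕ.^ k
    Pt≡ = trans (ℕ.*-comm P t) (trans (cong (t ℕ.*_) P≡) (sym (ℕ.*-assoc t _ _)))

-- The limit set

module Interpolation (em : ExcludedMiddle 0ℓ) (p : ℕ) (p-prime : Prime p)
  (K : Padic.FiniteExtension p p-prime) (absK : Padic.AbsoluteValue p p-prime K)
  {M q : ℕ} {{_ : ℕ.NonZero M}} {{_ : ℕ.NonZero q}}
  (s : ℕ → Padic.ℤₚ p p-prime) (σ : Fin M → Fin q → Padic.ℤₚ p p-prime → Padic.FiniteExtension.Carrier K)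
  (interpolation : Padic.ApproximateTwistedInterpolation p p-prime K absK s σ) where

  open Padic p p-prime
  open Classical em
  open PadicProperties em p p-prime
  open RatioProperties em p p-prime
  open Nearness em p p-prime K absK
  open FiniteExtension K using (ι) renaming (_≈_ to _≈ᴷ_; trans to ≈ᴷ-trans)
  open ApproximateTwistedInterpolation interpolation

  L : Pred ℤₚ 0ℓ
  L = limitSet K σ

  point : Fin q → ℤₚ → ℤₚ
  point r y = fromℕ (toℕ r) +ₚ fromℕ q *ₚ y

  point-Ball : ∀ r {y z m} → Ball z m y → Ball (point r z) m (point r y)
  point-Ball r {y} {z} {m} b = mod-+ (+ toℕ r) (+ toℕ r) (+ q ℤ.* res y m) (+ q ℤ.* res z m)
    (≡⇒mod {b = + toℕ r} refl)
    (mod-* (+ q) (+ q) (res y m) (res z m) (≡⇒mod {b = + q} refl) b)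

  σ-near : ∀ i r x k → ∃[ m ] (∀ y → Ball x m y → Near k (σ i r y) (σ i r x))
  σ-near i r = continuous⇒near (continuous i r)

  s-near : ∀ k → ∃[ N ] (∀ n → N ℕ.≤ n → ∀ i r → n ∈ A i r → Near k (ι (s n)) (σ i r (fromℕ n)))
  s-near k = let N , h = geometric-small C {D} (wrap 0≤D) D<1 (÷p^-pos k) in
    N , λ n n≥ i r n∈A → near (≤-trans {y = C Real.* D Real.^ n} (wrap (approx i r n n∈A)) (h n n≥))

  -- The image of ι is closed in K: terms near c are near each other, hence congruent, and a
  -- diagonal choice of residues defines z.
  complete : ∀ (x : ℕ → ℤₚ) c → (∀ k → Infinite (λ n → Near k (ι (x n)) c)) →
    ∃[ z ] (ι z ≈ᴷ c × (∀ β → Infinite (λ n → Ball z β (x n))))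
  complete x c h = z , near⇒≈ z-near , λ β N →
      t (β ℕ.⊔ N) , ℕ.≤-trans (ℕ.m≤n⊔m β N) (t≥ (β ℕ.⊔ N))
        , Ball-weaken {z} {x (t (β ℕ.⊔ N))} (ℕ.m≤m⊔n β N) (z-Ball (β ℕ.⊔ N))
    where
    -- Accuracy k + 1 leaves room for one use of `near-trans`; the lower bound k sends the chosen
    -- indices to infinity.
    t : ℕ → ℕ
    t k = proj₁ (h (suc k) k)

    t≥ : ∀ k → k ℕ.≤ t k
    t≥ k = proj₁ (proj₂ (h (suc k) k))

    t-near : ∀ k → Near (suc k) (ι (x (t k))) c
    t-near k = proj₂ (proj₂ (h (suc k) k))

    z : ℤₚ
    z = mkℤₚ (λ k → res (x (t k)) k) λ k →
      mod-trans (res (x (t (suc k))) (suc k)) (res (x (t (suc k))) k) (res (x (t k)) k)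
        (coherent (x (t (suc k))) k)
        (near⇒Ball {x (t (suc k))} {x (t k)} k
          (near-trans (near-weaken (ℕ.n≤1+n (suc k)) (t-near (suc k))) (near-sym (t-near k))))

    z-Ball : ∀ k → Ball z k (x (t k))
    z-Ball k = ≡⇒mod {b = res (x (t k)) k} refl

    z-near : ∀ k → Near k (ι z) c
    z-near k = near-trans
      (Ball⇒near {z} {x (t (suc k))} (suc k) (Ball-sym {z} {x (t (suc k))} (z-Ball (suc k))))
      (near-weaken (ℕ.n≤1+n (suc k)) (t-near (suc k)))

  -- The common core of both claims in (1): the x n are points of L for closedness, and terms of s
  -- for the second claim.
  limit-point : (i : ℕ → Fin M) (r : ℕ → Fin q) (x y : ℕ → ℤₚ) →
    (∀ k → ∃[ N ] (∀ n → N ℕ.≤ n → Near k (ι (x n)) (σ (i n) (r n) (point (r n) (y n))))) →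
    ∃[ z ] (z ∈ L × (∀ β → Infinite (λ n → Ball z β (x n))))
  limit-point i r x y h =
    let i₀ , inf₁ = pigeonhole {P = λ _ → ⊤} i (λ N → N , ℕ.≤-refl , tt)
        r₀ , inf₂ = pigeonhole r inf₁
        y₀ , inf₃ = cluster-point y inf₂
        w = point r₀ y₀
        c = σ i₀ r₀ w
        close : ∀ k → Infinite (λ n → Near k (ι (x n)) c)
        close k N₀ =
          let N , g = h (suc k)
              m , g′ = σ-near i₀ r₀ w (suc k)
              n , n≥ , ((_ , i≡) , r≡) , b = inf₃ m (N₀ ℕ.⊔ N)
          in n , ℕ.m⊔n≤o⇒m≤o N₀ N n≥ , near-trans
               (subst₂ (λ i r → Near (suc k) (ι (x n)) (σ i r (point r (y n)))) i≡ r≡ (g n (ℕ.m⊔n≤o⇒n≤o N₀ N n≥)))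
               (g′ (point r₀ (y n)) (point-Ball r₀ {y n} {y₀} b))
        z , ιz≈c , inf = complete x c close
    in z , (i₀ , r₀ , y₀ , ιz≈c) , inf

  L-resp-≈ₚ : ∀ {x y} → x ≈ₚ y → y ∈ L → x ∈ L
  L-resp-≈ₚ {x} {y} x≈y (i , r , z , e) = i , r , z , ≈ᴷ-trans (ι-cong {x} {y} x≈y) e

  L-closed : ∀ {x} → x ∉ L → ∃[ α ] (∀ {y} → Ball x α y → y ∉ L)
  L-closed {x} x∉L = by-contradiction λ h →
    let meets : ∀ α → ∃[ y ] (Ball x α y × y ∈ L)
        meets α = by-contradiction λ k → h (α , λ {y} b y∈L → k (y , b , y∈L))
        i = λ α → proj₁ (proj₂ (proj₂ (meets α)))
        r = λ α → proj₁ (proj₂ (proj₂ (proj₂ (meets α))))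
        y = λ α → proj₁ (proj₂ (proj₂ (proj₂ (proj₂ (meets α)))))
        e = λ α → proj₂ (proj₂ (proj₂ (proj₂ (proj₂ (meets α)))))
        x′ = λ α → proj₁ (meets α)
        z , z∈L , inf = limit-point i r x′ y (λ k → 0 , λ n _ → ≈⇒near (e n) k)
    in x∉L (L-resp-≈ₚ {x} {z} (λ β →
         -- An index n ≥ β puts x′ n in the β-balls of both z and x, so z and x agree modulo p^β.
         let n , n≥ , b = inf β β in
         Ball-trans {z} {x′ n} {x} b (Ball-sym {x} {x′ n} (Ball-weaken {x} {x′ n} n≥ (proj₁ (proj₂ (meets n))))))
       z∈L)

  s-eventually-near-L : ∀ β → ∃[ N ] (∀ n → N ℕ.≤ n → s n ∈ Nbhd L β)
  s-eventually-near-L β = by-contradiction λ h →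
    let far : ∀ N → ∃[ n ] (N ℕ.≤ n × s n ∉ Nbhd L β)
        far N = by-contradiction λ k → h (N , λ n n≥ → by-contradiction λ ∉ → k (n , n≥ , ∉))
        t = λ j → proj₁ (far j)
        i = λ j → residue M (+ t j)
        r = λ j → residue q (+ t j)
        -- Division with remainder exhibits the integer t j as a point of r + qℤₚ.
        y = λ j → fromℤ (+ t j ℤ./ℕ q)
        z , z∈L , inf = limit-point i r (λ j → s (t j)) y λ k →
          let N , g = s-near (suc k) in N , λ j j≥ → near-trans
            (g (t j) (ℕ.≤-trans j≥ (proj₁ (proj₂ (far j)))) (i j) (r j)
              (mod-residue M (+ t j) , mod-residue q (+ t j)))
            (σ-cong (i j) (r j) (fromℕ (t j)) (point (r j) (y j)) (λ m → ≡⇒mod (division (t j))) (suc k))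
        j , _ , b = inf β 0
    in proj₂ (proj₂ (far j)) (z , z∈L , b)
    where
    -- σ acts on representatives; its continuity is what makes it respect `_≈ₚ_`.
    σ-cong : ∀ i r x y → x ≈ₚ y → ∀ k → Near k (σ i r x) (σ i r y)
    σ-cong i r x y x≈y k = let m , h = σ-near i r y k in h x (x≈y m)

    division : ∀ n → + n ≡ + toℕ (residue q (+ n)) ℤ.+ + q ℤ.* (+ n ℤ./ℕ q)
    division n = trans (ℤ.a≡a%ℕn+[a/ℕn]*n (+ n) q)
      (cong₂ ℤ._+_ (cong +_ (sym (Fin.toℕ-fromℕ< (ℤ.n%ℕd<d (+ n) q)))) (ℤ.*-comm (+ n ℤ./ℕ q) (+ q)))

  L-approximated : ∀ f k → 1 ℕ.≤ f → p ℕ.^ f ≡ suc M → q ≡ p ℕ.^ k →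
    ∀ {x} → x ∈ L → ∀ α → ∃[ n ] Ball x α (s n)
  L-approximated f k 1≤f p^f≡ refl {x} (i , r , y , ιx≈) α =
    let w = point r y
        -- The two nested uses of `near-trans` at the end bring α + 2 down to α.
        m , h = σ-near i r w (suc (suc α))
        N , g = s-near (suc α)
        -- Precision m is for the continuity of σ at w; precision k forces n ≡ w ≡ r modulo q = p^k.
        l = m ℕ.⊔ k
        a = ℤ._%ℕ_ (res w l) (p ℕ.^ l) {{p^-nonZero l}}
        n , n≥ , mod-M , mod-a = crt′ l (toℕ i) a N
        b : Ball w l (fromℕ n)
        b = mod-trans (+ n) (+ a) (res w l) mod-a (mod-sym (res w l) (+ a) (mod-%ℕ (res w l) (p ℕ.^ l) {{p^-nonZero l}}))
        n≡r : + n ≡ + toℕ r [mod q ]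
        n≡r = mod-trans (+ n) (res w l) (+ toℕ r) (mod-weaken (ℕ.m≤n⊔m m k) (+ n) (res w l) b)
          (subst (+ q ∣_) (sym (+-ˡ (+ toℕ r) (+ q ℤ.* res y l))) (∣m⇒∣m*n (res y l) (divides (+ 1) (sym (ℤ.*-identityˡ (+ q))))))
    in n , near⇒Ball {s n} {x} α (near-trans (g n n≥ i r (mod-M , n≡r))
         (near-trans (h (fromℕ n) (Ball-weaken {w} {fromℕ n} (ℕ.m≤m⊔n m k) b)) (near-sym (≈⇒near ιx≈ (suc (suc α))))))
    where
    +-ˡ : ∀ a b → a ℤ.+ b ℤ.- a ≡ b
    +-ˡ = ℤ-Solver.solve 2 (λ a b → (a ℤ-Solver.:+ b) ℤ-Solver.:- a ℤ-Solver.:= b) refl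

    crt′ : ∀ l i a N → ∃[ n ] (N ℕ.≤ n × (+ n ≡ + i [mod M ]) × (+ n ≡ + a [mod p ℕ.^ l ]))
    crt′ l i a N = subst (λ M → ∃[ n ] (N ℕ.≤ n × (+ n ≡ + i [mod M ]) × (+ n ≡ + a [mod p ℕ.^ l ])))
      (ℕ.suc-pred M) (crt p f (ℕ.pred M) l i a N 1≤f (trans p^f≡ (cong suc (sym (ℕ.suc-pred M)))))

-- Haar measure

module Measure (em : ExcludedMiddle 0ℓ) (p : ℕ) (p-prime : Prime p) (haar : Padic.HaarMeasure p p-prime) where
  open Padic p p-prime
  open Classical em
  open PadicProperties em p p-prime
  open RatioProperties em p p-prime
  open HaarMeasure haar

  -- An empty set is disjoint from itself, so additivity applies to the family constantly equal to
  -- E, and a convergent constant series has no positive term.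
  μ-empty : ∀ {E} (b : IsBorel E) → (∀ {x} → x ∉ E) → μ E b ≤ᴿ 0ℝ
  μ-empty {E} b empty = ⟶-term {μ E b} {μ (⋃ ℕ (λ _ → E)) (union (λ _ → b))}
    (μ-additive (λ _ → b) (union (λ _ → b)) (λ _ (x∈E , _) → empty x∈E))

  module _ {E F U : Pred ℤₚ 0ℓ} (bE : IsBorel E) (bF : IsBorel F) (bU : IsBorel U)
    (E⊥F : E ⊥ F) (U≐E∪F : U ≐ E ∪ F) where

    private
      G : ℕ → Pred ℤₚ 0ℓ
      G 0 = E
      G 1 = F
      G _ = ∅

      bG : ∀ n → IsBorel (G n)
      bG 0             = bE
      bG 1             = bF
      bG (suc (suc _)) = open-set λ ()

      disjoint : ∀ {m n} → m ≢ n → G m ⊥ G n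
      disjoint {0}           {0}           m≢n _         = contradiction refl m≢n
      disjoint {0}           {1}           m≢n h         = E⊥F h
      disjoint {1}           {0}           m≢n (f , e)   = E⊥F (e , f)
      disjoint {1}           {1}           m≢n _         = contradiction refl m≢n
      disjoint {0}           {suc (suc _)} m≢n (_ , ())
      disjoint {1}           {suc (suc _)} m≢n (_ , ())
      disjoint {suc (suc _)} {_}           m≢n (() , _)

      U≐⋃G : U ≐ ⋃ ℕ G
      U≐⋃G = (λ x∈U → to (proj₁ U≐E∪F x∈U)) , λ { (0 , e) → proj₂ U≐E∪F (inj₁ e) ; (1 , f) → proj₂ U≐E∪F (inj₂ f) }
        where
        to : ∀ {x} → x ∈ E ∪ F → x ∈ ⋃ ℕ G
        to (inj₁ e) = 0 , e
        to (inj₂ f) = 1 , f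

      g : ℕ → ℝ
      g n = μ (G n) (bG n)

      lim : partialSum g ⟶ μ (⋃ ℕ G) (union bG)
      lim = μ-additive bG (union bG) disjoint

    -- Stated with bounds x and y on the summands: Agda compares real sums by unfolding them
    -- unless they agree syntactically, which the bounds ensure.
    μ-⊎-≤ : ∀ {x y} → μ E bE ≤ᴿ x → μ F bF ≤ᴿ y → μ U bU ≤ᴿ x Real.+ y
    μ-⊎-≤ hE hF = ≤-trans {y = μ (⋃ ℕ G) (union bG)} (≈⇒≤ (μ-cong bU (union bG) U≐⋃G))
      (⟶-two-≤ g {μ (⋃ ℕ G) (union bG)} hE hF (λ n → μ-empty (bG (2 ℕ.+ n)) (λ ())) lim)

    μ-⊎-≥ : ∀ {x y} → x ≤ᴿ μ E bE → y ≤ᴿ μ F bF → x Real.+ y ≤ᴿ μ U bU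
    μ-⊎-≥ hE hF = ≤-trans {y = μ (⋃ ℕ G) (union bG)}
      (⟶-two-≥ g {μ (⋃ ℕ G) (union bG)} hE hF (λ n → wrap (μ-nonneg (bG (2 ℕ.+ n)))) lim)
      (≈⇒≥ (μ-cong bU (union bG) U≐⋃G))

  -- Callers supply the Borel proof for F ∖ E: a difference of cylinders is a cylinder, and an open
  -- set minus a closed one is open.
  μ-mono : ∀ {E F} (bE : IsBorel E) (bF : IsBorel F) → IsBorel (F ∖ E) → E ⊆ F → μ E bE ≤ᴿ μ F bF
  μ-mono {E} {F} bE bF bF∖E E⊆F = linear₂ {x = μ E bE Real.+ μ (F ∖ E) bF∖E} {z = 0ℝ} {μ (F ∖ E) bF∖E}
    (μ-⊎-≥ bE bF∖E bF (λ (x∈E , _ , x∉E) → x∉E x∈E) (split , λ { (inj₁ x∈E) → E⊆F x∈E ; (inj₂ (x∈F , _)) → x∈F })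
      {μ E bE} {μ (F ∖ E) bF∖E} ≤-refl ≤-refl)
    (wrap (μ-nonneg bF∖E))
    λ n → solve 3 (λ e f d → e :+ (f :+ d) := f :+ ((e :+ d) :+ con 0ℚ)) refl
            (seq (μ E bE) n) (seq (μ F bF) n) (seq (μ (F ∖ E) bF∖E) n)
    where
    open ℚ-Solver
    split : F ⊆ E ∪ (F ∖ E)
    split {x} x∈F with em {x ∈ E}
    ... | yes x∈E = inj₁ x∈E
    ... | no  x∉E = inj₂ (x∈F , x∉E)

  -- Unions of cosets of p^α ℤₚ are open and stable under intersection and difference, which makes
  -- every Borel proof about them immediate.
  record Cylinder (α : ℕ) (E : Pred ℤₚ 0ℓ) : Set where
    constructor cylinder
    field saturated : ∀ {x y} → Ball x α y → x ∈ E → y ∈ E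

  open Cylinder

  cylinder-borel : ∀ {α E} → Cylinder α E → IsBorel E
  cylinder-borel {α} c = open-set λ {x} x∈E → α , λ {y} b → saturated c {x} {y} b x∈E

  cylinder-weaken : ∀ {α β E} → α ℕ.≤ β → Cylinder α E → Cylinder β E
  cylinder-weaken α≤β c = cylinder λ {x} {y} b → saturated c {x} {y} (Ball-weaken {x} {y} α≤β b)

  cylinder-∩ : ∀ {α E F} → Cylinder α E → Cylinder α F → Cylinder α (E ∩ F)
  cylinder-∩ c d = cylinder λ {x} {y} b (x∈E , x∈F) → saturated c {x} {y} b x∈E , saturated d {x} {y} b x∈F

  cylinder-∖ : ∀ {α E F} → Cylinder α E → Cylinder α F → Cylinder α (E ∖ F)
  cylinder-∖ c d = cylinder λ {x} {y} b (x∈E , x∉F) →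
    saturated c {x} {y} b x∈E , λ y∈F → x∉F (saturated d {y} {x} (Ball-sym {x} {y} b) y∈F)

  Ball-cylinder : ∀ x α → Cylinder α (Ball x α)
  Ball-cylinder x α = cylinder λ {y} {z} b y∈ → Ball-trans {x} {y} {z} y∈ b

  Nbhd-cylinder : ∀ E α → Cylinder α (Nbhd E α)
  Nbhd-cylinder E α = cylinder λ {x} {y} b (z , z∈E , x∈) → z , z∈E , Ball-trans {z} {x} {y} x∈ b

  Nbhd-antimono : ∀ E {α β} → α ℕ.≤ β → Nbhd E β ⊆ Nbhd E α
  Nbhd-antimono E α≤β {x} (y , y∈E , b) = y , y∈E , Ball-weaken {y} {x} α≤β b

  ⊆Nbhd : ∀ E {α} → E ⊆ Nbhd E α
  ⊆Nbhd E {α} {x} x∈E = x , x∈E , Ball-refl x α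

  μᶜ : ∀ {α E} → Cylinder α E → ℝ
  μᶜ {E = E} c = μ E (cylinder-borel c)

  μᶜ-mono : ∀ {α β E F} (c : Cylinder α E) (d : Cylinder β F) → E ⊆ F → μᶜ c ≤ᴿ μᶜ d
  μᶜ-mono {α} {β} c d = μ-mono (cylinder-borel c) (cylinder-borel d)
    (cylinder-borel (cylinder-∖ (cylinder-weaken (ℕ.m≤n⊔m α β) d) (cylinder-weaken (ℕ.m≤m⊔n α β) c)))

  μᶜ-subadditive : ∀ {α E F U} (c : Cylinder α E) (d : Cylinder α F) (u : Cylinder α U) → U ⊆ E ∪ F →
    ∀ {x y} → μᶜ c ≤ᴿ x → μᶜ d ≤ᴿ y → μᶜ u ≤ᴿ x Real.+ y
  μᶜ-subadditive {E = E} {F} {U} c d u U⊆ {x} {y} hE hF =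
    μ-⊎-≤ (cylinder-borel u∩c) (cylinder-borel u∖c) (cylinder-borel u)
      (λ ((_ , x∈E) , (_ , x∉E)) → x∉E x∈E)
      (split , λ { (inj₁ (x∈U , _)) → x∈U ; (inj₂ (x∈U , _)) → x∈U })
      {x} {y}
      (≤-trans (μᶜ-mono u∩c c proj₂) hE)
      (≤-trans (μᶜ-mono u∖c d λ (x∈U , x∉E) → inF (U⊆ x∈U) x∉E) hF)
    where
    u∩c = cylinder-∩ u c
    u∖c = cylinder-∖ u c
    split : U ⊆ (U ∩ E) ∪ (U ∖ E)
    split {x} x∈U with em {x ∈ E}
    ... | yes x∈E = inj₁ (x∈U , x∈E)
    ... | no  x∉E = inj₂ (x∈U , x∉E)
    inF : ∀ {x} → x ∈ E ∪ F → x ∉ E → x ∈ F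
    inF (inj₁ x∈E) x∉E = contradiction x∈E x∉E
    inF (inj₂ x∈F) _   = x∈F

  Balls : ∀ {C : Set} → (C → ℤₚ) → ℕ → List C → Pred ℤₚ 0ℓ
  Balls center α cs x = Any (λ c → Ball (center c) α x) cs

  Balls-cylinder : ∀ {C : Set} (center : C → ℤₚ) α cs → Cylinder α (Balls center α cs)
  Balls-cylinder center α cs = cylinder λ {x} {y} b → Any.map λ {c} x∈ → Ball-trans {center c} {x} {y} x∈ b

  ÷p^-suc : ∀ c α → 1 ÷p^ α ℚ.+ c ÷p^ α ≡ suc c ÷p^ α
  ÷p^-suc c α = ÷-+ 1 c (p ℕ.^ α) {{p^-nonZero α}}

  -- Repeated balls are allowed here, as the first N terms of s may be congruent; the lower bound
  -- below needs incongruent centres.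
  μ-Balls-≤ : ∀ {C : Set} (center : C → ℤₚ) α cs → μᶜ (Balls-cylinder center α cs) ≤ᴿ ratio (length cs) α
  μ-Balls-≤ center α []       = ≤-trans {y = 0ℝ} (μ-empty (cylinder-borel (Balls-cylinder center α [])) λ ())
    (fromℚ-mono-≤ {b = 0 ÷p^ α} (÷-mono-≤ 0 1 0 (p ℕ.^ α) {{_}} {{p^-nonZero α}} ℕ.z≤n))
  μ-Balls-≤ center α (c ∷ cs) = ≤-trans {y = ratio 1 α Real.+ ratio (length cs) α}
    (μᶜ-subadditive (Ball-cylinder (center c) α) (Balls-cylinder center α cs) (Balls-cylinder center α (c ∷ cs))
      (λ { (here b) → inj₁ b ; (there bs) → inj₂ bs })
      {ratio 1 α} {ratio (length cs) α}
      (≈⇒≤ (μ-ball (center c) α (cylinder-borel (Ball-cylinder (center c) α))))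
      (μ-Balls-≤ center α cs))
    (≗⇒≤ λ _ → ÷p^-suc (length cs) α)

  μ-Balls-≥ : ∀ {C : Set} (center : C → ℤₚ) α cs → AllPairs (λ c d → ¬ Ball (center c) α (center d)) cs →
    ratio (length cs) α ≤ᴿ μᶜ (Balls-cylinder center α cs)
  μ-Balls-≥ center α []       _ = ≤-trans {y = 0ℝ}
    (fromℚ-mono-≤ {a = 0 ÷p^ α} (÷-mono-≤ 0 (p ℕ.^ α) 0 1 {{p^-nonZero α}} ℕ.z≤n))
    (wrap (μ-nonneg (cylinder-borel (Balls-cylinder center α []))))
  μ-Balls-≥ center α (c ∷ cs) (c# AllPairs.∷ cs#) =
    ≤-trans {y = ratio 1 α Real.+ ratio (length cs) α} (≗⇒≤ λ _ → sym (÷p^-suc (length cs) α))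
    (μ-⊎-≥ (cylinder-borel (Ball-cylinder (center c) α)) (cylinder-borel (Balls-cylinder center α cs))
      (cylinder-borel (Balls-cylinder center α (c ∷ cs)))
      (λ {x} (b , bs) → disjoint {x} b c# bs)
      ((λ { (here b) → inj₁ b ; (there bs) → inj₂ bs }) , (λ { (inj₁ b) → here b ; (inj₂ bs) → there bs }))
      {ratio 1 α} {ratio (length cs) α}
      (≈⇒≥ (μ-ball (center c) α (cylinder-borel (Ball-cylinder (center c) α)))) (μ-Balls-≥ center α cs cs#))
    where
    disjoint : ∀ {x ds} → Ball (center c) α x → All (λ d → ¬ Ball (center c) α (center d)) ds → ¬ Balls center α ds x
    disjoint {x} b (c#d All.∷ _)  (here {d} b′)  = c#d (Ball-trans {center c} {x} {center d} b (Ball-sym {center d} {x} b′))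
    disjoint {x} b (_ All.∷ c#ds) (there bs) = disjoint {x} b c#ds bs

  -- Residue counts as measures

  module _ (s : ℕ → ℤₚ) (α : ℕ) where

    residue-center : Fin (p ℕ.^ α) → ℤₚ
    residue-center a = fromℕ (toℕ a)

    residue-list : List (Fin (p ℕ.^ α))
    residue-list = filter (λ a → em {residues s α a}) (allFin (p ℕ.^ α))

    -- The set S_α of the overview, indexed by terms of the sequence.
    orbit : Pred ℤₚ 0ℓ
    orbit x = ∃[ n ] Ball (s n) α x

    orbit-cylinder : Cylinder α orbit
    orbit-cylinder = cylinder λ {x} {y} b (n , x∈) → n , Ball-trans {s n} {x} {y} x∈ b

    orbit⊆Balls : orbit ⊆ Balls residue-center α residue-list
    orbit⊆Balls {x} (n , b) = List.lose (∈-filter⁺ (λ a → em {residues s α a}) (∈-allFin a) (n , s≡a)) x≡a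
      where
      a = residue (p ℕ.^ α) {{p^-nonZero α}} (res x α)
      x≡a : res x α ≡ + toℕ a [mod p ℕ.^ α ]
      x≡a = mod-residue (p ℕ.^ α) {{p^-nonZero α}} (res x α)
      s≡a : res (s n) α ≡ + toℕ a [mod p ℕ.^ α ]
      s≡a = mod-trans (res (s n) α) (res x α) (+ toℕ a) (mod-sym (res x α) (res (s n) α) b) x≡a

    Balls⊆orbit : Balls residue-center α residue-list ⊆ orbit
    Balls⊆orbit {x} bs =
      let a , a∈ , x≡a = List.find bs
          _ , n , s≡a = ∈-filter⁻ (λ a → em {residues s α a}) {xs = allFin (p ℕ.^ α)} a∈
      in n , mod-trans (res x α) (+ toℕ a) (res (s n) α) x≡a (mod-sym (res (s n) α) (+ toℕ a) s≡a)

    card≤μ-orbit : ratio (card em (residues s α)) α ≤ᴿ μᶜ orbit-cylinder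
    card≤μ-orbit = ≤-trans
      (μ-Balls-≥ residue-center α residue-list
        (AllPairs.map (λ {a} {b} a≢b e → a≢b (sym (mod-injective b a e)))
          (filter⁺ (λ a → em {residues s α a}) (allFin⁺ (p ℕ.^ α)))))
      (μᶜ-mono (Balls-cylinder residue-center α residue-list) orbit-cylinder λ {x} → Balls⊆orbit {x})

    μ-orbit≤card : μᶜ orbit-cylinder ≤ᴿ ratio (card em (residues s α)) α
    μ-orbit≤card = ≤-trans (μᶜ-mono orbit-cylinder (Balls-cylinder residue-center α residue-list) λ {x} → orbit⊆Balls {x})
      (μ-Balls-≤ residue-center α residue-list)

  -- Outer approximation of a closed set

  module _ {E : Pred ℤₚ 0ℓ} (bE : IsBorel E) (closed : ∀ {x} → x ∉ E → ∃[ α ] (∀ {y} → Ball x α y → y ∉ E)) where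

    private
      μN : ℕ → ℝ
      μN n = μᶜ (Nbhd-cylinder E n)

      shell-cylinder : ∀ n → Cylinder (suc n) (Nbhd E n ∖ Nbhd E (suc n))
      shell-cylinder n = cylinder-∖ (cylinder-weaken (ℕ.n≤1+n n) (Nbhd-cylinder E n)) (Nbhd-cylinder E (suc n))

      G : ℕ → Pred ℤₚ 0ℓ
      G zero    = E
      G (suc n) = Nbhd E n ∖ Nbhd E (suc n)

      bG : ∀ n → IsBorel (G n)
      bG zero    = bE
      bG (suc n) = cylinder-borel (shell-cylinder n)

      g : ℕ → ℝ
      g n = μ (G n) (bG n)

      below : ∀ {m n x} → m ℕ.< n → x ∈ G m → x ∉ G n
      below {zero}  {suc n} m<n       x∈E       (_ , x∉) = x∉ (⊆Nbhd E x∈E)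
      below {suc m} {suc n} {x} (ℕ.s≤s m<n) (_ , x∉) (x∈ , _) = x∉ (Nbhd-antimono E m<n {x} x∈)

      disjoint : ∀ {m n} → m ≢ n → G m ⊥ G n
      disjoint {m} {n} m≢n {x} (x∈m , x∈n) with ℕ.<-cmp m n
      ... | tri< m<n _ _ = below {m} {n} {x} m<n x∈m x∈n
      ... | tri≈ _ m≡n _ = contradiction m≡n m≢n
      ... | tri> _ _ n<m = below {n} {m} {x} n<m x∈n x∈m

      -- Closedness enters here: a point outside E leaves some neighbourhood, and the stage at which
      -- it leaves names its shell.
      N₀⊆⋃G : Nbhd E 0 ⊆ ⋃ ℕ G
      N₀⊆⋃G {x} x∈N₀ with em {x ∈ E}
      ... | yes x∈E = 0 , x∈E
      ... | no  x∉E =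
        let α , away = closed {x} x∉E
            j , x∈ , x∉ = least-failure {P = λ n → x ∈ Nbhd E n} x∈N₀ α
              (λ (y , y∈E , b) → away {y} (Ball-sym {y} {x} b) y∈E)
        in suc j , x∈ , x∉

      ⋃G⊆N₀ : ⋃ ℕ G ⊆ Nbhd E 0
      ⋃G⊆N₀ {x} (zero  , x∈E)      = ⊆Nbhd E x∈E
      ⋃G⊆N₀ {x} (suc n , x∈ , _) = Nbhd-antimono E ℕ.z≤n {x} x∈

      split : ∀ n → Nbhd E n ≐ (Nbhd E n ∖ Nbhd E (suc n)) ∪ Nbhd E (suc n)
      split n = (λ {x} → to {x}) , λ {x} → λ { (inj₁ (x∈ , _)) → x∈ ; (inj₂ x∈) → Nbhd-antimono E (ℕ.n≤1+n n) {x} x∈ }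
        where
        to : Nbhd E n ⊆ (Nbhd E n ∖ Nbhd E (suc n)) ∪ Nbhd E (suc n)
        to {x} x∈ with em {x ∈ Nbhd E (suc n)}
        ... | yes x∈′ = inj₂ x∈′
        ... | no  x∉′ = inj₁ (x∈ , x∉′)

      -- Sums the inequalities μ(shell n) + μ(E_{n+1}) ≤ μ(E_n); the sum starts with μ(E), which is
      -- term 0 of g.
      telescope : ∀ n → partialSum g (suc n) Real.+ μN n ≤ᴿ μ E bE Real.+ μN 0
      telescope zero    = ≗⇒≤ λ n → cong (ℚ._+ seq (μN 0) n) (ℚ.+-identityˡ (seq (μ E bE) n))
      telescope (suc n) = linear₂ {x = partialSum g (suc n) Real.+ μN n} {z = g (suc n) Real.+ μN (suc n)} (telescope n)
        (μ-⊎-≥ (bG (suc n)) (cylinder-borel (Nbhd-cylinder E (suc n))) (cylinder-borel (Nbhd-cylinder E n))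
          (λ ((_ , x∉) , x∈) → x∉ x∈) (split n) {g (suc n)} {μN (suc n)} ≤-refl ≤-refl)
        λ k → solve 6 (λ P u a b e z → ((P :+ u) :+ b) :+ ((e :+ z) :+ a) := (e :+ z) :+ ((P :+ a) :+ (u :+ b))) refl
          (seq (partialSum g (suc n)) k) (seq (g (suc n)) k) (seq (μN n) k) (seq (μN (suc n)) k) (seq (μ E bE) k) (seq (μN 0) k)
        where open ℚ-Solver

    -- The partial sums reach μ(E_0) up to δ, so telescoping leaves at most μ(E) + δ for μ(E_N).
    μ-Nbhd-approximates : ∀ δ → 0ℚ ℚ.< δ → ∃[ β ] (μᶜ (Nbhd-cylinder E β) ≤ᴿ μ E bE Real.+ fromℚ δ)
    μ-Nbhd-approximates δ 0<δ =
      let N , k = ⟶⇒≤ {partialSum g} {μ (⋃ ℕ G) (union bG)} (μ-additive bG (union bG) disjoint) δ 0<δ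
          N₀≤ : μN 0 ≤ᴿ partialSum g (suc N) Real.+ fromℚ δ
          N₀≤ = ≤-trans {y = μ (⋃ ℕ G) (union bG)} (≈⇒≤ (μ-cong (cylinder-borel (Nbhd-cylinder E 0)) (union bG) (N₀⊆⋃G , ⋃G⊆N₀)))
            (proj₂ (k (suc N) (ℕ.n≤1+n N)))
      in N , linear₂ {x = partialSum g (suc N) Real.+ μN N} {z = μN 0} (telescope N) N₀≤ λ n →
        solve 5 (λ P a e z d → a :+ ((e :+ z) :+ (P :+ d)) := (e :+ d) :+ ((P :+ a) :+ z)) refl
          (seq (partialSum g (suc N)) n) (seq (μN N) n) (seq (μ E bE) n) (seq (μN 0) n) δ
      where open ℚ-Solver

-- Comparison of the counts with the measure of L

module _ (em : ExcludedMiddle 0ℓ) (p : ℕ) (p-prime : Prime p)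
  (K : Padic.FiniteExtension p p-prime) (absK : Padic.AbsoluteValue p p-prime K) (haar : Padic.HaarMeasure p p-prime)
  (f k : ℕ) (1≤f : 1 ℕ.≤ f) {M q : ℕ} (p^f≡1+M : p ℕ.^ f ≡ suc M) (q≡p^k : q ≡ p ℕ.^ k)
  {{_ : ℕ.NonZero M}} {{_ : ℕ.NonZero q}}
  (s : ℕ → Padic.ℤₚ p p-prime) (σ : Fin M → Fin q → Padic.ℤₚ p p-prime → Padic.FiniteExtension.Carrier K)
  (interpolation : Padic.ApproximateTwistedInterpolation p p-prime K absK s σ) where

  open Padic p p-prime
  open Classical em
  open PadicProperties em p p-prime
  open RatioProperties em p p-prime
  open Interpolation em p p-prime K absK s σ interpolation
  open Measure em p p-prime haar
  open HaarMeasure haar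

  L-borel : IsBorel L
  L-borel = respects ((λ {x} x∉∁L → by-contradiction x∉∁L) , λ x∈L x∉L → x∉L x∈L)
    (complement (open-set {∁ L} λ {x} x∉L → let α , away = L-closed {x} x∉L in α , λ {y} → away {y}))

  μL≤μ-orbit : ∀ α → μ L L-borel ≤ᴿ μᶜ (orbit-cylinder s α)
  μL≤μ-orbit α = μ-mono L-borel (cylinder-borel (orbit-cylinder s α)) (open-set outside) λ {x} x∈L →
      let n , b = L-approximated f k 1≤f p^f≡1+M q≡p^k {x} x∈L α in n , Ball-sym {x} {s n} b
    where
    outside : IsOpen (orbit s α ∖ L)
    outside {x} ((n , x∈) , x∉L) = let β , away = L-closed {x} x∉L in α ℕ.⊔ β , λ {y} b →
      (n , Ball-trans {s n} {x} {y} x∈ (Ball-weaken {x} {y} (ℕ.m≤m⊔n α β) b)) , away {y} (Ball-weaken {x} {y} (ℕ.m≤n⊔m α β) b)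

  -- As β ≤ α, the coset of a late term lies wholly in L_β; the N early terms occupy at most N
  -- further cosets.
  μ-orbit≤ : ∀ {β N} → (∀ n → N ℕ.≤ n → s n ∈ Nbhd L β) → ∀ {α} → β ℕ.≤ α →
    ∀ {x y} → μᶜ (Nbhd-cylinder L β) ≤ᴿ x → ratio N α ≤ᴿ y → μᶜ (orbit-cylinder s α) ≤ᴿ x Real.+ y
  μ-orbit≤ {β} {N} late {α} β≤α {x} {y} Nbhd≤x ratio≤y =
    μᶜ-subadditive (cylinder-weaken β≤α (Nbhd-cylinder L β)) (Balls-cylinder s α (upTo N)) (orbit-cylinder s α)
      (λ {x} (n , b) → cover {x} n b (N ℕ.≤? n)) {x} {y}
      (≤-trans (μᶜ-mono (cylinder-weaken β≤α (Nbhd-cylinder L β)) (Nbhd-cylinder L β) (λ {x} x∈ → x∈)) Nbhd≤x)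
      (≤-trans (subst (λ l → μᶜ (Balls-cylinder s α (upTo N)) ≤ᴿ ratio l α) (length-upTo N) (μ-Balls-≤ s α (upTo N))) ratio≤y)
    where
    cover : ∀ {x} n → Ball (s n) α x → Dec (N ℕ.≤ n) → x ∈ Nbhd L β ∪ Balls s α (upTo N)
    cover {x} n b (yes N≤n) = let z , z∈L , b′ = late n N≤n in
      inj₁ (z , z∈L , Ball-trans {z} {s n} {x} b′ (Ball-weaken {s n} {x} β≤α b))
    cover {x} n b (no N≰n) = inj₂ (List.lose (∈-upTo⁺ (ℕ.≰⇒> N≰n)) b)

  counts⟶μL : (λ α → ratio (card em (residues s α)) α) ⟶ μ L L-borel
  counts⟶μL = ≤⇒⟶ {λ α → ratio (card em (residues s α)) α} {μ L L-borel} λ δ 0<δ →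
    -- Half of δ pays for replacing L by L_β, the other half for the early cosets.
    let β , near-β = μ-Nbhd-approximates {L} L-borel (λ {x} → L-closed {x}) (½ ℚ.* δ) (½-pos 0<δ)
        N , late   = s-eventually-near-L β
        A , small  = ÷p^-small N (½-pos 0<δ)
    in A ℕ.⊔ β , λ α α≥ →
      ≤-trans (card≤μ-orbit s α) (≤-trans {y = μ L L-borel Real.+ fromℚ (½ ℚ.* δ) Real.+ fromℚ (½ ℚ.* δ)}
        (μ-orbit≤ {β} {N} late {α} (ℕ.m⊔n≤o⇒n≤o A β α≥) {μ L L-borel Real.+ fromℚ (½ ℚ.* δ)} {fromℚ (½ ℚ.* δ)}
          near-β (fromℚ-mono-≤ (small α (ℕ.m⊔n≤o⇒m≤o A β α≥))))
        (≗⇒≤ λ n → trans (ℚ.+-assoc (seq (μ L L-borel) n) (½ ℚ.* δ) (½ ℚ.* δ)) (cong (seq (μ L L-borel) n ℚ.+_) (½+½ δ)))) ,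
      lower δ 0<δ {ratio (card em (residues s α)) α} {μ L L-borel} (≤-trans (μL≤μ-orbit α) (μ-orbit≤card s α))
    where
    lower : ∀ δ → 0ℚ ℚ.< δ → ∀ {c l} → l ≤ᴿ c → l ≤ᴿ c Real.+ fromℚ δ
    lower δ 0<δ {c} {l} h = ≤-trans h (linear₁ {x = fromℚ 0ℚ} {fromℚ δ} (fromℚ-mono-≤ (ℚ.<⇒≤ 0<δ)) λ m →
      sym (ℚ.+-identityʳ (seq c m ℚ.+ δ)))

theorem4p3 : (em : ExcludedMiddle 0ℓ)
    (p : ℕ) (p-prime : Prime p) (f : ℕ) → 1 ≤ f →
    (q : ℕ) → ∃[ k ] (q ≡ p ^ k) →
    let open Padic p p-prime in
    (K : FiniteExtension) (absK : AbsoluteValue K) (haar : HaarMeasure) →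
    let open HaarMeasure haar in
    (s : ℕ → ℤₚ) (σ : Fin (p ^ f ∸ 1) → Fin q → ℤₚ → FiniteExtension.Carrier K) →
    ApproximateTwistedInterpolation K absK s σ →
    Σ[ b ∈ IsBorel (limitSet K σ) ]
    ((λ α → ratio (card em (residues s α)) α) Real.⟶ μ (limitSet K σ) b)
theorem4p3 em p p-prime f 1≤f q (k , q≡p^k) K absK haar s σ interpolation =
  L-borel em p p-prime K absK haar f k 1≤f p^f≡1+M q≡p^k s σ interpolation ,
  counts⟶μL em p p-prime K absK haar f k 1≤f p^f≡1+M q≡p^k s σ interpolation
  where
  open PadicProperties em p p-prime using (p-nonZero; p^-nonZero)
  open RatioProperties em p p-prime using (p≥2)

  -- Makes the truncated subtraction in p^f ∸ 1 exact and the modulus p^f - 1 nonzero.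
  p^f≥2 : 2 ≤ p ^ f
  p^f≥2 = ℕ.≤-trans p≥2 (subst (_≤ p ^ f) (ℕ.*-identityʳ p) (ℕ.^-monoʳ-≤ p 1≤f))

  p^f≡1+M : p ^ f ≡ suc (p ^ f ∸ 1)
  p^f≡1+M = sym (ℕ.m+[n∸m]≡n {1} (ℕ.≤-trans (ℕ.n≤1+n 1) p^f≥2))

  instance
    M-nonZero : ℕ.NonZero (p ^ f ∸ 1)
    M-nonZero = ℕ.>-nonZero (ℕ.∸-monoˡ-≤ 1 p^f≥2)

    q-nonZero : ℕ.NonZero q
    q-nonZero = subst ℕ.NonZero (sym q≡p^k) (p^-nonZero k)
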